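{- Let $\Phi$ be a reduced crystallographic root system with simple roots $\alpha_1,\dots,\alpha_n$. Let $I\subseteq\{1,\dots,n\}$ be an arbitrary subset of modified vertices and $J=\{1,\dots,n\}\setminus I$. Then the Modified Kostant Game with active set $I$ terminates in a unique final configuration $\mathbf c^{(I)}_{final}$. Moreover, the total number of chips $|\mathbf c^{(I)}_{final}|$ in this final configuration satisfies $$|\mathbf c^{(I)}_{final}|=\sum_{\gamma^\vee\in(\Phi^\vee)^+\setminus(\Phi_J^\vee)^+}\mathrm{ht}_I(\gamma^\vee).$$
   Context: Let $E$ be a Euclidean space with inner product $\langle\cdot,\cdot\rangle$, $\Phi\subset E$ a reduced crystallographic root system with base $\alpha_1,\dots,\alpha_n$. For a root $\alpha$ the coroot is $\alpha^\vee=2\alpha/\langle\alpha,\alpha\rangle$; $\Phi^\vee$ is the set of coroots, with base $\alpha_1^\vee,\dots,\alpha_n^\vee$ and positive coroots $(\Phi^\vee)^+$. For $J\subseteq\{1,\dots,n\}$, $(\Phi_J^\vee)^+$ is the set of positive coroots lying in the span of $\{\alpha_j^\vee: j\in J\}$. For a coroot $\gamma^\vee=\sum_{j=1}^n k_j\alpha_j^\vee$, its $I$-height is $\mathrm{ht}_I(\gamma^\vee)=\sum_{j\in I}k_j$. Modified Kostant Game with active set $I$ (vertices of the Dynkin diagram of $\Phi$ are identified with $1,\dots,n$): a configuration is a vector $c=(c_1,\dots,c_n)\in\mathbb Z_{\ge0}^n$; its total number of chips is $|c|=\sum_{v=1}^n c_v$. For a vertex $v$, let $N(v)$ be the set of its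 neighbours in the Dynkin diagram, and for $u\in N(v)$ let $n_{v,u}=-\langle\alpha_u,\alpha_v^\vee\rangle$ (so $n_{v,u}=1$ if $\alpha_v$ is at least as long as $\alpha_u$, and $n_{v,u}\in\{2,3\}$, the number of edges joining $u$ and $v$, if $\alpha_v$ is shorter than $\alpha_u$). Let $\epsilon_v=1$ if $v\in I$ and $\epsilon_v=0$ otherwise. The vertex $v$ is sad in $c$ if $c_v<\tfrac12\left(\sum_{u\in N(v)}n_{v,u}c_u+\epsilon_v\right)$. A move consists of choosing a sad vertex $v$ and firing it: $c_v$ is replaced by $\sum_{u\in N(v)}n_{v,u}c_u+\epsilon_v-c_v$ and all other entries are unchanged. The game starts from $\mathbf 0$ and ends when no vertex is sad. "Terminates in a unique final configuration" means that there is no infinite sequence of moves and that every maximal sequence of moves ends in the same configuration. -}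

module Defs where

open import Level using (_⊔_) renaming (suc to lsuc)
open import Algebra.Bundles using (CommutativeRing; RawMonoid)
open import Algebra.Definitions.RawMonoid using (sum) renaming (_×_ to multiple)
open import Algebra.Module.Bundles using (Module)
open import Data.Bool.Base using (if_then_else_)
open import Data.Fin.Base using (Fin; zero; suc)
open import Data.Fin.Properties using (_≟_; all?)
open import Data.Fin.Subset using (Subset; _∈_; _∉_; ∁)
open import Data.Fin.Subset.Properties using (_∈?_)
open import Data.Integer.Base as ℤ using (ℤ; +_; -[1+_]; 0ℤ)
import Data.Integer.Properties as ℤₚ
open import Data.Nat.Base using (ℕ; zero; suc)
open import Data.Product.Base using (Σ-syntax; ∃-syntax; _×_; _,_; proj₁; proj₂)
open import Data.Sum.Base using (_⊎_)
open import Data.Vec.Base using (Vec; lookup; replicate; _[_]≔_)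
import Algebra.Properties.CommutativeMonoid.Sum as CommutativeMonoidSum
import Algebra.Properties.Group as GroupProperties
import Algebra.Properties.Ring as RingProperties
open import Relation.Binary.Construct.Closure.ReflexiveTransitive using (Star)
import Relation.Binary.Construct.StrictToNonStrict as StrictToNonStrict
import Relation.Binary.Reasoning.Setoid as SetoidReasoning
open import Relation.Binary.Core using (Rel)
open import Relation.Binary.PropositionalEquality.Core using (_≡_; _≢_)
open import Relation.Binary.Structures using (IsStrictTotalOrder)
open import Relation.Nullary.Decidable using (Dec; does; map′; ¬?; _×-dec_; _→-dec_)
open import Relation.Nullary.Negation.Core using (¬_)
open import Relation.Unary using (Pred; Decidable)

sumOver : ∀ {a ℓ p} (M : RawMonoid a ℓ) {n} {P : Pred (Fin n) p} → Decidable P →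
          (Fin n → RawMonoid.Carrier M) → RawMonoid.Carrier M
sumOver M P? f = sum M λ i → if does (P? i) then f i else RawMonoid.ε M

-- ℝ is replaced by an arbitrary linearly ordered field.  As usual, the
-- inverse is total, with an unspecified value at 0#.
record OrderedField c ℓ₁ ℓ₂ : Set (lsuc (c ⊔ ℓ₁ ⊔ ℓ₂)) where
  infix 4 _<_
  infix 9 _⁻¹
  field
    commutativeRing : CommutativeRing c ℓ₁
  open CommutativeRing commutativeRing public hiding (zero)
  field
    _<_                : Rel Carrier ℓ₂
    _⁻¹                : Carrier → Carrier
    isStrictTotalOrder : IsStrictTotalOrder _≈_ _<_
    0<1                : 0# < 1#
    +-monoˡ-<          : ∀ z {x y} → x < y → (x + z) < (y + z)
    *-pos              : ∀ {x y} → 0# < x → 0# < y → 0# < (x * y)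
    ⁻¹-inverseʳ        : ∀ {x} → x ≉ 0# → (x * x ⁻¹) ≈ 1#

  open IsStrictTotalOrder isStrictTotalOrder public
    using (_<?_; compare; irrefl; <-respʳ-≈; <-respˡ-≈)
    renaming (trans to <-trans; _≟_ to _≈?_)
  open StrictToNonStrict _≈_ _<_ public using (_≤_)

  2# : Carrier
  2# = 1# + 1#

  fromℕ : ℕ → Carrier
  fromℕ k = multiple +-rawMonoid k 1#

  fromℤ : ℤ → Carrier
  fromℤ (+ k)      = fromℕ k
  fromℤ (-[1+ k ]) = - fromℕ (suc k)

-- Finite dimension is not a field here: it follows, for the spaces in
-- question, from the finite spanning set in RootSystem below.
record EuclideanSpace {c ℓ₁ ℓ₂} (K : OrderedField c ℓ₁ ℓ₂) m ℓm
                      : Set (c ⊔ ℓ₁ ⊔ ℓ₂ ⊔ lsuc (m ⊔ ℓm)) where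
  open OrderedField K
  field
    vectorSpace : Module commutativeRing m ℓm
  open Module vectorSpace public
  field
    ⟨_,_⟩       : Carrierᴹ → Carrierᴹ → Carrier
    ⟨⟩-cong     : ∀ {x x′ y y′} → x ≈ᴹ x′ → y ≈ᴹ y′ → ⟨ x , y ⟩ ≈ ⟨ x′ , y′ ⟩
    ⟨⟩-sym      : ∀ x y → ⟨ x , y ⟩ ≈ ⟨ y , x ⟩
    ⟨⟩-+ˡ       : ∀ x y z → ⟨ x +ᴹ y , z ⟩ ≈ (⟨ x , z ⟩ + ⟨ y , z ⟩)
    ⟨⟩-*ˡ       : ∀ a x y → ⟨ a *ₗ x , y ⟩ ≈ (a * ⟨ x , y ⟩)
    ⟨⟩-positive : ∀ {x} → x ≉ᴹ 0ᴹ → 0# < ⟨ x , x ⟩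

  linComb : ∀ {n} → (Fin n → Carrier) → (Fin n → Carrierᴹ) → Carrierᴹ
  linComb k v = sum +ᴹ-rawMonoid λ j → k j *ₗ v j

  infix 9 _ᵛ
  _ᵛ : Carrierᴹ → Carrierᴹ
  α ᵛ = (2# * ⟨ α , α ⟩ ⁻¹) *ₗ α

  reflect : Carrierᴹ → Carrierᴹ → Carrierᴹ
  reflect α x = x +ᴹ -ᴹ (⟨ x , α ᵛ ⟩ *ₗ α)

-- The finite set Φ is given by an enumeration without repetitions, so
-- the elements of Fin size stand for the roots.
record RootSystem {c ℓ₁ ℓ₂ m ℓm} {K : OrderedField c ℓ₁ ℓ₂} (E : EuclideanSpace K m ℓm)
                  : Set (c ⊔ ℓ₁ ⊔ ℓ₂ ⊔ m ⊔ ℓm) where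
  open OrderedField K
  open EuclideanSpace E
  field
    size             : ℕ
    root             : Fin size → Carrierᴹ
    root-injective   : ∀ {r s} → root r ≈ᴹ root s → r ≡ s
    spans            : ∀ x → ∃[ k ] x ≈ᴹ linComb k root
    nonzero          : ∀ r → root r ≉ᴹ 0ᴹ
    reflect-closed   : ∀ r s → ∃[ t ] root t ≈ᴹ reflect (root r) (root s)
    reduced          : ∀ r s a → root s ≈ᴹ a *ₗ root r → (a ≈ 1#) ⊎ (a ≈ - 1#)
    crystallographic : ∀ r s → ∃[ z ] ⟨ root s , root r ᵛ ⟩ ≈ fromℤ z

  coroot : Fin size → Carrierᴹ
  coroot r = root r ᵛ

  -- cartanInteger s r = ⟨ s , rᵛ ⟩
  cartanInteger : Fin size → Fin size → ℤ
  cartanInteger s r = proj₁ (crystallographic r s)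

record Base {c ℓ₁ ℓ₂ m ℓm} {K : OrderedField c ℓ₁ ℓ₂} {E : EuclideanSpace K m ℓm}
            (Φ : RootSystem E) (n : ℕ) : Set (c ⊔ ℓ₁ ⊔ ℓ₂ ⊔ m ⊔ ℓm) where
  open OrderedField K
  open EuclideanSpace E
  open RootSystem Φ
  field
    simple : Fin n → Fin size
    independent : ∀ k → linComb k (λ j → root (simple j)) ≈ᴹ 0ᴹ → ∀ j → k j ≈ 0#
    integral    : ∀ r → Σ[ z ∈ (Fin n → ℤ) ]
      (root r ≈ᴹ linComb (λ j → fromℤ (z j)) (λ j → root (simple j)) ×
       ((∀ j → 0ℤ ℤ.≤ z j) ⊎ (∀ j → z j ℤ.≤ 0ℤ)))

  α αᵛ : Fin n → Carrierᴹ
  α  j = root (simple j)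
  αᵛ j = coroot (simple j)

module Coroots {c ℓ₁ ℓ₂ m ℓm} {K : OrderedField c ℓ₁ ℓ₂} {E : EuclideanSpace K m ℓm}
               {Φ : RootSystem E} {n} (Δ : Base Φ n) where
  open OrderedField K
  open EuclideanSpace E
  open RootSystem Φ
  open Base Δ

  private
    module +G  = GroupProperties +-group
    module R   = RingProperties ring
    open CommutativeMonoidSum +ᴹ-commutativeMonoid using (sum-cong-≋; ∑-distrib-+)

    *ₗ-sum : ∀ {k} a (x : Fin k → Carrierᴹ) →
             a *ₗ sum +ᴹ-rawMonoid x ≈ᴹ sum +ᴹ-rawMonoid λ j → a *ₗ x j
    *ₗ-sum {zero}  a x = *ₗ-zeroʳ a
    *ₗ-sum {suc k} a x =
      ≈ᴹ-trans (*ₗ-distribˡ a _ _) (+ᴹ-congˡ (*ₗ-sum a λ j → x (suc j)))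

    linComb-∸ : ∀ {k} (a b : Fin k → Carrier) (x : Fin k → Carrierᴹ) →
                linComb a x ≈ᴹ linComb b x → linComb (λ j → a j + - 1# * b j) x ≈ᴹ 0ᴹ
    linComb-∸ a b x eq = begin
      linComb (λ j → a j + - 1# * b j) x
        ≈⟨ sum-cong-≋ (λ j → ≈ᴹ-trans (*ₗ-distribʳ (x j) (a j) _)
                                        (+ᴹ-congˡ (*ₗ-assoc (- 1#) (b j) (x j)))) ⟩
      sum +ᴹ-rawMonoid (λ j → a j *ₗ x j +ᴹ - 1# *ₗ (b j *ₗ x j))
        ≈⟨ ∑-distrib-+ (λ j → a j *ₗ x j) (λ j → - 1# *ₗ (b j *ₗ x j)) ⟩
      linComb a x +ᴹ sum +ᴹ-rawMonoid (λ j → - 1# *ₗ (b j *ₗ x j))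
        ≈⟨ +ᴹ-cong eq (≈ᴹ-sym (*ₗ-sum (- 1#) (λ j → b j *ₗ x j))) ⟩
      linComb b x +ᴹ - 1# *ₗ linComb b x
        ≈⟨ +ᴹ-congʳ (*ₗ-identityˡ _) ⟨
      1# *ₗ linComb b x +ᴹ - 1# *ₗ linComb b x
        ≈⟨ *ₗ-distribʳ _ 1# (- 1#) ⟨
      (1# + - 1#) *ₗ linComb b x
        ≈⟨ *ₗ-congʳ (-‿inverseʳ 1#) ⟩
      0# *ₗ linComb b x
        ≈⟨ *ₗ-zeroˡ _ ⟩
      0ᴹ ∎
      where open SetoidReasoning ≈ᴹ-setoid

    pos⇒≉0 : ∀ {x} → 0# < x → x ≉ 0#
    pos⇒≉0 0<x x≈0 = irrefl (sym x≈0) 0<x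

    2≉0 : 2# ≉ 0#
    2≉0 = pos⇒≉0 (<-trans 0<1 (<-respˡ-≈ (+-identityˡ 1#) (+-monoˡ-< 1# 0<1)))

    -- coroot r = t r *ₗ root r, and t r is invertible with inverse h r
    t h : Fin size → Carrier
    t r = 2# * ⟨ root r , root r ⟩ ⁻¹
    h r = ⟨ root r , root r ⟩ * 2# ⁻¹

    h*t : ∀ r → h r * t r ≈ 1#
    h*t r = begin
      (q * 2# ⁻¹) * (2# * q ⁻¹)  ≈⟨ *-assoc q _ _ ⟩
      q * (2# ⁻¹ * (2# * q ⁻¹))  ≈⟨ *-congˡ (*-assoc _ 2# _) ⟨
      q * ((2# ⁻¹ * 2#) * q ⁻¹)  ≈⟨ *-congˡ (*-congʳ (trans (*-comm _ 2#) (⁻¹-inverseʳ 2≉0))) ⟩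
      q * (1# * q ⁻¹)            ≈⟨ *-congˡ (*-identityˡ _) ⟩
      q * q ⁻¹                   ≈⟨ ⁻¹-inverseʳ (pos⇒≉0 (⟨⟩-positive (nonzero r))) ⟩
      1#                         ∎
      where
      open SetoidReasoning setoid
      q = ⟨ root r , root r ⟩

  coroot-independent : ∀ k → linComb k αᵛ ≈ᴹ 0ᴹ → ∀ j → k j ≈ 0#
  coroot-independent k eq j = begin
    k j                                   ≈⟨ *-identityʳ (k j) ⟨
    k j * 1#                              ≈⟨ *-congˡ (h*t (simple j)) ⟨
    k j * (h (simple j) * t (simple j))   ≈⟨ *-congˡ (*-comm _ _) ⟩
    k j * (t (simple j) * h (simple j))   ≈⟨ *-assoc (k j) _ _ ⟨
    (k j * t (simple j)) * h (simple j)   ≈⟨ *-congʳ (independent (λ i → k i * t (simple i)) eq′ j) ⟩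
    0# * h (simple j)                     ≈⟨ zeroˡ _ ⟩
    0#                                    ∎
    where
    open SetoidReasoning setoid
    eq′ : linComb (λ i → k i * t (simple i)) α ≈ᴹ 0ᴹ
    eq′ = ≈ᴹ-trans (sum-cong-≋ λ i → *ₗ-assoc (k i) _ _) eq

  coroot-expansion : ∀ r → ∃[ k ] coroot r ≈ᴹ linComb k αᵛ
  coroot-expansion r = k , (begin
    t r *ₗ root r                               ≈⟨ *ₗ-congˡ (proj₁ (proj₂ (integral r))) ⟩
    t r *ₗ linComb (λ j → fromℤ (z j)) α        ≈⟨ *ₗ-sum (t r) (λ j → fromℤ (z j) *ₗ α j) ⟩
    sum +ᴹ-rawMonoid (λ j → t r *ₗ (fromℤ (z j) *ₗ α j))
                                                ≈⟨ sum-cong-≋ step ⟩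
    linComb k αᵛ                                ∎)
    where
    open SetoidReasoning ≈ᴹ-setoid
    z = proj₁ (integral r)
    k : Fin n → Carrier
    k j = t r * (fromℤ (z j) * h (simple j))
    step : ∀ j → t r *ₗ (fromℤ (z j) *ₗ α j) ≈ᴹ k j *ₗ αᵛ j
    step j = begin
      t r *ₗ (fromℤ (z j) *ₗ α j)
        ≈⟨ *ₗ-congˡ (*ₗ-congˡ (*ₗ-identityˡ (α j))) ⟨
      t r *ₗ (fromℤ (z j) *ₗ (1# *ₗ α j))
        ≈⟨ *ₗ-congˡ (*ₗ-congˡ (*ₗ-congʳ (h*t (simple j)))) ⟨
      t r *ₗ (fromℤ (z j) *ₗ ((h (simple j) * t (simple j)) *ₗ α j))
        ≈⟨ *ₗ-congˡ (*ₗ-congˡ (*ₗ-assoc (h (simple j)) _ _)) ⟩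
      t r *ₗ (fromℤ (z j) *ₗ (h (simple j) *ₗ αᵛ j))
        ≈⟨ *ₗ-congˡ (*ₗ-assoc (fromℤ (z j)) _ _) ⟨
      t r *ₗ ((fromℤ (z j) * h (simple j)) *ₗ αᵛ j)
        ≈⟨ *ₗ-assoc (t r) _ _ ⟨
      k j *ₗ αᵛ j ∎

  -- The k_j of γᵛ = Σ k_j αᵛ_j.  They are in fact integers; as elements of
  -- the ordered field, in which ℕ embeds, they give the same equation for heights.
  coefficient : Fin size → Fin n → Carrier
  coefficient r = proj₁ (coroot-expansion r)

  coefficient-unique : ∀ r k → coroot r ≈ᴹ linComb k αᵛ → ∀ j → k j ≈ coefficient r j
  coefficient-unique r k eq j = begin
    k j                        ≈⟨ +G.inverseˡ-unique (k j) _ diff ⟩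
    - (- 1# * coefficient r j) ≈⟨ -‿cong (R.-1*x≈-x _) ⟩
    - (- coefficient r j)      ≈⟨ +G.⁻¹-involutive _ ⟩
    coefficient r j            ∎
    where
    open SetoidReasoning setoid
    diff = coroot-independent _
      (linComb-∸ k (coefficient r) αᵛ (≈ᴹ-trans (≈ᴹ-sym eq) (proj₂ (coroot-expansion r)))) j

  Positive : Fin size → Set (c ⊔ ℓ₁ ⊔ ℓ₂ ⊔ ℓm)
  Positive r = ∃[ k ] (coroot r ≈ᴹ linComb k αᵛ × ∀ j → 0# ≤ k j)

  InSpan : Subset n → Fin size → Set (c ⊔ ℓ₁ ⊔ ℓm)
  InSpan J r = ∃[ k ] (coroot r ≈ᴹ linComb k αᵛ × ∀ j → j ∉ J → k j ≈ 0#)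

  private
    open StrictToNonStrict _≈_ _<_ using (decidable)
    ≤-dec : ∀ x y → Dec (x ≤ y)
    ≤-dec = decidable _≈?_ _<?_

    ≤-respʳ-≈ : ∀ {x y z} → y ≈ z → x ≤ y → x ≤ z
    ≤-respʳ-≈ = StrictToNonStrict.≤-respʳ-≈ _≈_ _<_ trans <-respʳ-≈

  positive? : Decidable Positive
  positive? r = map′
    (λ p → coefficient r , proj₂ (coroot-expansion r) , p)
    (λ { (k , eq , p) j → ≤-respʳ-≈ (coefficient-unique r k eq j) (p j) })
    (all? λ j → ≤-dec 0# (coefficient r j))

  inSpan? : ∀ J → Decidable (InSpan J)
  inSpan? J r = map′
    (λ p → coefficient r , proj₂ (coroot-expansion r) , p)
    (λ { (k , eq , p) j j∉J → trans (sym (coefficient-unique r k eq j)) (p j j∉J) })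
    (all? λ j → ¬? (j ∈? J) →-dec (coefficient r j ≈? 0#))

  height : Subset n → Fin size → Carrier
  height I r = sumOver +-rawMonoid (_∈? I) (coefficient r)

  heightSum : Subset n → Carrier
  heightSum I = sumOver +-rawMonoid
    (λ r → positive? r ×-dec ¬? (inSpan? (∁ I) r)) (height I)

module Game {c ℓ₁ ℓ₂ m ℓm} {K : OrderedField c ℓ₁ ℓ₂} {E : EuclideanSpace K m ℓm}
            {Φ : RootSystem E} {n} (Δ : Base Φ n) (I : Subset n) where
  open RootSystem Φ
  open Base Δ

  Config : Set
  Config = Vec ℕ n

  start : Config
  start = replicate n 0

  -- The number of edges of the Dynkin diagram between two distinct vertices.
  edges : Fin n → Fin n → ℤ
  edges v u = cartanInteger (simple v) (simple u) ℤ.* cartanInteger (simple u) (simple v)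

  Neighbour : Fin n → Fin n → Set
  Neighbour v u = u ≢ v × edges v u ≢ 0ℤ

  neighbour? : ∀ v → Decidable (Neighbour v)
  neighbour? v u = ¬? (u ≟ v) ×-dec ¬? (edges v u ℤₚ.≟ 0ℤ)

  weight : Fin n → Fin n → ℤ
  weight v u = ℤ.- cartanInteger (simple u) (simple v)

  ε : Fin n → ℤ
  ε v = if does (v ∈? I) then ℤ.1ℤ else 0ℤ

  demand : Config → Fin n → ℤ
  demand c v =
    sumOver ℤ.+-0-rawMonoid (neighbour? v) (λ u → weight v u ℤ.* + lookup c u) ℤ.+ ε v

  -- c_v < ½ demand, cleared of the denominator
  Sad : Config → Fin n → Set
  Sad c v = + 2 ℤ.* + lookup c v ℤ.< demand c v

  -- A sad vertex always has a new value k ∈ ℕ, since demand − c_v > c_v ≥ 0.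
  data _⟶_ (c : Config) : Config → Set where
    fire : ∀ v {k} → Sad c v → + k ≡ demand c v ℤ.- + lookup c v → c ⟶ (c [ v ]≔ k)

  Final : Config → Set
  Final c = ∀ v → ¬ Sad c v

  record TerminatesUniquelyAt (final : Config) : Set where
    field
      no-infinite-play : ¬ (Σ[ s ∈ (ℕ → Config) ] (s 0 ≡ start × ∀ i → s i ⟶ s (suc i)))
      reachable        : Star _⟶_ start final
      isFinal          : Final final
      unique           : ∀ c → Star _⟶_ start c → Final c → c ≡ final

module Submission where

-- Let x = Σ c_u α_u and level x γ = ⟨x, γᵛ⟩ − ht_I(γᵛ).  Firing v is the affine
-- reflection x ↦ x − (level x α_v) α_v; it precomposes the level with s_v, and v is sad
-- exactly when level x α_v < 0.  Since s_v permutes the positive roots other than α_v,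
-- every move lowers the number of positive roots of negative level by one, so the game
-- terminates, and preserves |c| + Σ_{γ>0} max(0, − level x γ).  At 0 this invariant is
-- the sum of the I-heights, and at a final configuration it is |c|.
-- For uniqueness, the exchange argument shows that a dominant point dominates every
-- point of its orbit, so two final configurations dominate each other.

open import Defs
open import Algebra.Bundles using (CommutativeMonoid; Ring)
import Algebra.Module.Properties.LeftModule as LeftModuleProperties
import Algebra.Properties.CommutativeMonoid.Sum as CommutativeMonoidSum
import Algebra.Properties.CommutativeSemigroup as CommutativeSemigroupProperties
import Algebra.Properties.Group as GroupProperties
import Algebra.Properties.Ring as RingProperties
import Algebra.Properties.Semiring.Mult as SemiringMult
import Algebra.Properties.Semiring.Sum as SemiringSum
import Algebra.Solver.Ring as RingSolver
open import Algebra.Solver.Ring.AlmostCommutativeRing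
  using (fromCommutativeRing; _-Raw-AlmostCommutative⟶_)
open import Data.Bool.Base using (Bool; true; false; if_then_else_)
open import Data.Fin.Base using (Fin; zero; suc)
open import Data.Fin.Permutation using (permutation)
import Data.Fin.Properties as Fin
open import Data.Fin.Subset using (Subset; ∁)
open import Data.Fin.Subset.Properties using (_∈?_; x∈p⇒x∉∁p)
open import Data.Integer.Base as ℤ using (ℤ; +_; -[1+_]; _⊖_)
import Data.Integer.Properties as ℤ
open import Data.List.Base
  using (List; []; _∷_; _++_; _∷ʳ_; foldr; length; initLast; _∷ʳ′_)
open import Data.List.Properties using (foldr-++; foldr-∷ʳ; length-++)
open import Data.Maybe.Base using (Maybe; just; nothing)
open import Data.Nat.Base as ℕ using (ℕ; zero; suc)
import Data.Nat.Properties as ℕ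
open import Data.Product.Base using (Σ-syntax; ∃-syntax; _×_; _,_; proj₁; proj₂)
open import Data.Sum.Base as Sum using (_⊎_; inj₁; inj₂)
open import Data.Vec.Base using (Vec; []; _∷_; sum; lookup; replicate; tabulate; _[_]≔_)
open import Data.Vec.Properties
  using (lookup∘update; lookup∘update′; lookup-replicate; tabulate∘lookup; tabulate-cong)
open import Function.Base using (_∘_)
open import Function.Bundles using (mk⇔)
open import Relation.Binary.Construct.Closure.ReflexiveTransitive as Star using (Star; _◅_)
import Relation.Binary.Construct.StrictToNonStrict as StrictToNonStrict
open import Relation.Binary.Definitions using (tri<; tri≈; tri>)
open import Relation.Binary.PropositionalEquality.Core as ≡ using (_≡_; _≢_)
open import Relation.Binary.PropositionalEquality.Properties using (module ≡-Reasoning)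
import Relation.Binary.Reasoning.Setoid as SetoidReasoning
open import Relation.Nullary.Decidable
  using (Dec; yes; no; does; does-⇔; dec-true; dec-false; ¬?; _×-dec_)
open import Relation.Nullary.Negation.Core using (¬_; contradiction)
open import Relation.Unary using (Pred; Decidable)

-- Two sad vertices can be fired in either order, but bringing the two plays together again may take
-- a whole braid relation, so local confluence would lead to a study of rank-two subsystems. The
-- order argument avoids this: words in the affine reflections stand for Weyl group elements, and a
-- final point is compared with its whole orbit at once. The correction term of the invariant has
-- one source. Firing v permutes the terms of all positive roots except α_v. The term of α_v was
-- minus its level and drops out, and the same number is what the move adds to c_v. Coroots appear
-- in the answer because the level is linear in γᵛ, and positive coroots in the span of J may be
-- left out because their I-height is zero. Points, levels and heights live in the ordered field,
-- while chips and Cartan integers are integral. The embedding of ℤ carries statements from one side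
-- to the other; its injectivity turns equality of points back into equality of configurations.

module IndicatorSums {a ℓ} (M : CommutativeMonoid a ℓ) where
  open CommutativeMonoid M
  open CommutativeMonoidSum M using (sum-cong-≋; sum-replicate-zero; ∑-distrib-+; sum-permute)
    renaming (sum to ∑)

  when : Bool → Carrier → Carrier
  when b x = if b then x else ε

  ∑-at : ∀ {n} (i : Fin n) (x : Fin n → Carrier) →
         ∑ (λ j → when (does (j Fin.≟ i)) (x j)) ≈ x i
  ∑-at {suc n} zero x = trans (∙-congˡ (sum-replicate-zero n)) (identityʳ _)
  ∑-at {suc n} (suc i) x = trans (identityˡ _) (∑-at i (x ∘ suc))

  -- The selections b and b ∘ s differ exactly by i and s i.
  ∑-involution : ∀ {n} (b : Fin n → Bool) (s : Fin n → Fin n) → (∀ j → s (s j) ≡ j) →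
    ∀ {i} → b i ≡ true → b (s i) ≡ false →
    (∀ j → j ≢ i → j ≢ s i → b (s j) ≡ b j) → (x : Fin n → Carrier) →
    ∑ (λ j → when (b j) (x (s j))) ∙ x i ≈ ∑ (λ j → when (b j) (x j)) ∙ x (s i)
  ∑-involution {n} b s invol {i} bi bsi stable x = begin
    ∑ (λ j → when (b j) (x (s j))) ∙ x i
      ≈⟨ ∙-congʳ (sum-permute (λ j → when (b j) (x (s j))) (permutation s s invol invol)) ⟩
    ∑ (λ j → when (b (s j)) (x (s (s j)))) ∙ x i
      ≈⟨ ∙-congʳ (sum-cong-≋ λ j → reflexive (≡.cong (when (b (s j)) ∘ x) (invol j))) ⟩
    ∑ (λ j → when (b (s j)) (x j)) ∙ x i
      ≈⟨ ∙-congˡ (∑-at i x) ⟨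
    ∑ (λ j → when (b (s j)) (x j)) ∙ ∑ (at i)
      ≈⟨ ∑-distrib-+ (λ j → when (b (s j)) (x j)) (at i) ⟨
    ∑ (λ j → when (b (s j)) (x j) ∙ at i j)
      ≈⟨ sum-cong-≋ pointwise ⟩
    ∑ (λ j → when (b j) (x j) ∙ at (s i) j)
      ≈⟨ ∑-distrib-+ (λ j → when (b j) (x j)) (at (s i)) ⟩
    ∑ (λ j → when (b j) (x j)) ∙ ∑ (at (s i))
      ≈⟨ ∙-congˡ (∑-at (s i) x) ⟩
    ∑ (λ j → when (b j) (x j)) ∙ x (s i) ∎
    where
    open SetoidReasoning setoid
    at : Fin n → Fin n → Carrier
    at k j = when (does (j Fin.≟ k)) (x j)
    -- At i the left summand is switched off by `bsi` and the extra term supplies x i; at s i the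
    -- roles are exchanged. A fixed point i ≡ s i would contradict `bi` and `bsi`.
    pointwise : ∀ j → when (b (s j)) (x j) ∙ at i j ≈ when (b j) (x j) ∙ at (s i) j
    pointwise j with j Fin.≟ i | j Fin.≟ s i
    ... | yes ≡.refl | yes i≡si = contradiction
      (≡.trans (≡.sym bi) (≡.trans (≡.cong b i≡si) bsi)) λ ()
    ... | yes ≡.refl | no _ rewrite bi | bsi = comm _ _
    ... | no _ | yes ≡.refl rewrite invol i | bi | bsi = comm _ _
    ... | no j≢i | no j≢si rewrite stable j j≢i j≢si = refl

-- The integers in an ordered field, signs and inverses

module OrderedFieldProperties {c ℓ₁ ℓ₂} (K : OrderedField c ℓ₁ ℓ₂) where
  open OrderedField K

  open GroupProperties +-group using (ε⁻¹≈ε; ⁻¹-involutive)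
  open RingProperties ring using (-‿distribˡ-*; -‿distribʳ-*; -‿+-comm)
  open SemiringMult semiring using (×-homo-+; ×1-homo-*)
  open SemiringSum semiring using () renaming (sum to ∑)
  open SetoidReasoning setoid

  fromℕ-+ : ∀ i j → fromℕ (i ℕ.+ j) ≈ fromℕ i + fromℕ j
  fromℕ-+ = ×-homo-+ 1#

  fromℤ-⊖ : ∀ i j → fromℤ (i ⊖ j) ≈ fromℕ i + - fromℕ j
  fromℤ-⊖ i zero = sym (trans (+-congˡ ε⁻¹≈ε) (+-identityʳ _))
  fromℤ-⊖ zero (suc j) = sym (+-identityˡ _)
  fromℤ-⊖ (suc i) (suc j) = begin
    fromℤ (suc i ⊖ suc j)                       ≡⟨ ≡.cong fromℤ (ℤ.[1+m]⊖[1+n]≡m⊖n i j) ⟩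
    fromℤ (i ⊖ j)                               ≈⟨ fromℤ-⊖ i j ⟩
    fromℕ i + - fromℕ j                         ≈⟨ +-congʳ (+-identityʳ _) ⟨
    (fromℕ i + 0#) + - fromℕ j                  ≈⟨ +-congʳ (+-congˡ (-‿inverseʳ 1#)) ⟨
    (fromℕ i + (1# + - 1#)) + - fromℕ j         ≈⟨ +-congʳ (+-assoc _ _ _) ⟨
    ((fromℕ i + 1#) + - 1#) + - fromℕ j         ≈⟨ +-assoc _ _ _ ⟩
    (fromℕ i + 1#) + (- 1# + - fromℕ j)         ≈⟨ +-cong (+-comm _ _) (-‿+-comm _ _) ⟩
    (1# + fromℕ i) + - (1# + fromℕ j)           ∎

  fromℤ-neg : ∀ i → fromℤ (ℤ.- i) ≈ - fromℤ i
  fromℤ-neg (+ zero)   = sym ε⁻¹≈ε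
  fromℤ-neg (+ suc i)  = refl
  fromℤ-neg -[1+ i ]   = sym (⁻¹-involutive _)

  fromℤ-+ : ∀ i j → fromℤ (i ℤ.+ j) ≈ fromℤ i + fromℤ j
  fromℤ-+ (+ i)    (+ j)    = fromℕ-+ i j
  fromℤ-+ (+ i)    -[1+ j ] = fromℤ-⊖ i (suc j)
  fromℤ-+ -[1+ i ] (+ j)    = trans (fromℤ-⊖ j (suc i)) (+-comm _ _)
  fromℤ-+ -[1+ i ] -[1+ j ] = begin
    - fromℕ (suc (suc (i ℕ.+ j)))       ≡⟨ ≡.cong (λ k → - fromℕ (suc k)) (ℕ.+-suc i j) ⟨
    - fromℕ (suc i ℕ.+ suc j)           ≈⟨ -‿cong (fromℕ-+ (suc i) (suc j)) ⟩
    - (fromℕ (suc i) + fromℕ (suc j))   ≈⟨ -‿+-comm _ _ ⟨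
    - fromℕ (suc i) + - fromℕ (suc j)   ∎

  private
    fromℤ-*-ℕ : ∀ i j → fromℤ (i ℤ.* + j) ≈ fromℤ i * fromℕ j
    fromℤ-*-ℕ (+ i) j = begin
      fromℤ (+ i ℤ.* + j)   ≡⟨ ≡.cong fromℤ (ℤ.pos-* i j) ⟨
      fromℕ (i ℕ.* j)       ≈⟨ ×1-homo-* i j ⟩
      fromℕ i * fromℕ j     ∎
    fromℤ-*-ℕ -[1+ i ] j = begin
      fromℤ (-[1+ i ] ℤ.* + j)          ≡⟨ ≡.cong fromℤ (ℤ.neg-distribˡ-* (+ suc i) (+ j)) ⟨
      fromℤ (ℤ.- (+ suc i ℤ.* + j))     ≈⟨ fromℤ-neg (+ suc i ℤ.* + j) ⟩
      - fromℤ (+ suc i ℤ.* + j)         ≈⟨ -‿cong (fromℤ-*-ℕ (+ suc i) j) ⟩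
      - (fromℕ (suc i) * fromℕ j)       ≈⟨ -‿distribˡ-* _ _ ⟩
      - fromℕ (suc i) * fromℕ j         ∎

  fromℤ-* : ∀ i j → fromℤ (i ℤ.* j) ≈ fromℤ i * fromℤ j
  fromℤ-* i (+ j)    = fromℤ-*-ℕ i j
  fromℤ-* i -[1+ j ] = begin
    fromℤ (i ℤ.* -[1+ j ])            ≡⟨ ≡.cong fromℤ (ℤ.neg-distribʳ-* i (+ suc j)) ⟨
    fromℤ (ℤ.- (i ℤ.* + suc j))       ≈⟨ fromℤ-neg (i ℤ.* + suc j) ⟩
    - fromℤ (i ℤ.* + suc j)           ≈⟨ -‿cong (fromℤ-*-ℕ i (suc j)) ⟩
    - (fromℤ i * fromℕ (suc j))       ≈⟨ -‿distribʳ-* _ _ ⟩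
    fromℤ i * - fromℕ (suc j)         ∎

  private
    fromℤ-morphism : Ring.rawRing ℤ.+-*-ring
                       -Raw-AlmostCommutative⟶ fromCommutativeRing commutativeRing
    fromℤ-morphism = record
      { ⟦_⟧    = fromℤ
      ; +-homo = fromℤ-+
      ; *-homo = fromℤ-*
      ; -‿homo = fromℤ-neg
      ; 0-homo = refl
      ; 1-homo = +-identityʳ 1#
      }

    fromℤ-≟ : ∀ i j → Maybe (fromℤ i ≈ fromℤ j)
    fromℤ-≟ i j with i ℤ.≟ j
    ... | yes i≡j = just (reflexive (≡.cong fromℤ i≡j))
    ... | no  _   = nothing

  -- With coefficients in ℤ, whose equality is decided, the normal forms collect multiples and
  -- recognise cancellation. Numerals such as `con (+ 2)` then denote the integers of the game.
  module Solver = RingSolver (Ring.rawRing ℤ.+-*-ring) (fromCommutativeRing commutativeRing)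
                             fromℤ-morphism fromℤ-≟
  open StrictToNonStrict _≈_ _<_ public using (<⇒≤)
  private module N = StrictToNonStrict _≈_ _<_

  ≤-respˡ-≈ : ∀ {x y z} → x ≈ y → x ≤ z → y ≤ z
  ≤-respˡ-≈ = N.≤-respˡ-≈ sym trans <-respˡ-≈

  ≤-respʳ-≈ : ∀ {x y z} → y ≈ z → x ≤ y → x ≤ z
  ≤-respʳ-≈ = N.≤-respʳ-≈ trans <-respʳ-≈

  ≤-antisym : ∀ {x y} → x ≤ y → y ≤ x → x ≈ y
  ≤-antisym = N.antisym isEquivalence <-trans irrefl

  ≤-<-trans : ∀ {x y z} → x ≤ y → y < z → x < z
  ≤-<-trans = N.≤-<-trans sym <-trans <-respˡ-≈

  ≤⇒≯ : ∀ {x y} → x ≤ y → ¬ (y < x)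
  ≤⇒≯ x≤y y<x = irrefl refl (≤-<-trans x≤y y<x)

  <⇒≉ : ∀ {x} → 0# < x → x ≉ 0#
  <⇒≉ 0<x x≈0 = irrefl (sym x≈0) 0<x

  0<2 : 0# < 2#
  0<2 = <-trans 0<1 (<-respˡ-≈ (+-identityˡ 1#) (+-monoˡ-< 1# 0<1))

  0<-⇒<0 : ∀ {x} → 0# < - x → x < 0#
  0<-⇒<0 {x} p = <-respˡ-≈ (+-identityˡ x) (<-respʳ-≈ (-‿inverseˡ x) (+-monoˡ-< x p))

  <0⇒0<- : ∀ {x} → x < 0# → 0# < - x
  <0⇒0<- {x} p = <-respˡ-≈ (-‿inverseʳ x) (<-respʳ-≈ (+-identityˡ _) (+-monoˡ-< (- x) p))

  +-pos-nonneg : ∀ {x y} → 0# < x → 0# ≤ y → 0# < x + y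
  +-pos-nonneg {x} {y} 0<x 0≤y =
    ≤-<-trans (≤-respʳ-≈ (sym (+-identityˡ y)) 0≤y) (+-monoˡ-< y 0<x)

  +-nonneg : ∀ {x y} → 0# ≤ x → 0# ≤ y → 0# ≤ x + y
  +-nonneg (inj₁ 0<x) 0≤y = inj₁ (+-pos-nonneg 0<x 0≤y)
  +-nonneg (inj₂ 0≈x) 0≤y = ≤-respʳ-≈ (trans (sym (+-identityˡ _)) (+-congʳ 0≈x)) 0≤y

  ≤-+-nonneg : ∀ {x y} → 0# ≤ y → x ≤ x + y
  ≤-+-nonneg {x} {y} (inj₁ 0<y) =
    inj₁ (<-respʳ-≈ (+-comm y x) (<-respˡ-≈ (+-identityˡ x) (+-monoˡ-< x 0<y)))
  ≤-+-nonneg {x} {y} (inj₂ 0≈y) = inj₂ (trans (sym (+-identityʳ x)) (+-congˡ 0≈y))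

  *-nonneg : ∀ {x y} → 0# ≤ x → 0# ≤ y → 0# ≤ x * y
  *-nonneg (inj₁ 0<x) (inj₁ 0<y) = inj₁ (*-pos 0<x 0<y)
  *-nonneg (inj₁ 0<x) (inj₂ 0≈y) = inj₂ (sym (trans (*-congˡ (sym 0≈y)) (zeroʳ _)))
  *-nonneg (inj₂ 0≈x) _          = inj₂ (sym (trans (*-congʳ (sym 0≈x)) (zeroˡ _)))

  *-nonneg-nonpos : ∀ {x y} → 0# ≤ x → y ≤ 0# → x * y ≤ 0#
  *-nonneg-nonpos (inj₁ 0<x) (inj₁ y<0) = inj₁
    (0<-⇒<0 (<-respʳ-≈ (sym (-‿distribʳ-* _ _)) (*-pos 0<x (<0⇒0<- y<0))))
  *-nonneg-nonpos (inj₁ 0<x) (inj₂ y≈0) = inj₂ (trans (*-congˡ y≈0) (zeroʳ _))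
  *-nonneg-nonpos (inj₂ 0≈x) _          = inj₂ (trans (*-congʳ (sym 0≈x)) (zeroˡ _))

  ∑-nonneg : ∀ {n} {x : Fin n → Carrier} → (∀ j → 0# ≤ x j) → 0# ≤ ∑ x
  ∑-nonneg {zero}  0≤x = inj₂ refl
  ∑-nonneg {suc n} 0≤x = +-nonneg (0≤x zero) (∑-nonneg (0≤x ∘ suc))

  ⁻¹-inverseˡ : ∀ {x} → x ≉ 0# → x ⁻¹ * x ≈ 1#
  ⁻¹-inverseˡ x≉0 = trans (*-comm _ _) (⁻¹-inverseʳ x≉0)

  -- A zero or negative inverse would make the product 1 zero or negative.
  ⁻¹-pos : ∀ {x} → 0# < x → 0# < x ⁻¹
  ⁻¹-pos {x} 0<x with compare 0# (x ⁻¹)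
  ... | tri< p _ _ = p
  ... | tri≈ _ p _ = contradiction
    (trans (sym (⁻¹-inverseʳ (<⇒≉ 0<x))) (trans (*-congˡ (sym p)) (zeroʳ x)))
    (<⇒≉ 0<1)
  ... | tri> _ _ p = contradiction
    (0<-⇒<0 (<-respʳ-≈ (trans (sym (-‿distribʳ-* x (x ⁻¹))) (-‿cong (⁻¹-inverseʳ (<⇒≉ 0<x))))
                       (*-pos 0<x (<0⇒0<- p))))
    (≤⇒≯ (<⇒≤ 0<1))

  -- Compatibility of `_⁻¹` with `_≈_` is not a field of the record; away from zero it follows from
  -- uniqueness of inverses.
  ⁻¹-cong : ∀ {x y} → x ≉ 0# → x ≈ y → x ⁻¹ ≈ y ⁻¹
  ⁻¹-cong {x} {y} x≉0 x≈y = begin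
    x ⁻¹              ≈⟨ *-identityʳ _ ⟨
    x ⁻¹ * 1#         ≈⟨ *-congˡ (⁻¹-inverseʳ (x≉0 ∘ trans x≈y)) ⟨
    x ⁻¹ * (y * y ⁻¹) ≈⟨ *-assoc _ _ _ ⟨
    (x ⁻¹ * y) * y ⁻¹ ≈⟨ *-congʳ (*-congˡ x≈y) ⟨
    (x ⁻¹ * x) * y ⁻¹ ≈⟨ *-congʳ (⁻¹-inverseˡ x≉0) ⟩
    1# * y ⁻¹         ≈⟨ *-identityˡ _ ⟩
    y ⁻¹              ∎

  *-cancelʳ : ∀ {x y z} → z ≉ 0# → x * z ≈ y * z → x ≈ y
  *-cancelʳ {x} {y} {z} z≉0 eq = begin
    x               ≈⟨ undo x ⟩
    (x * z) * z ⁻¹  ≈⟨ *-congʳ eq ⟩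
    (y * z) * z ⁻¹  ≈⟨ undo y ⟨
    y               ∎
    where
    undo : ∀ u → u ≈ (u * z) * z ⁻¹
    undo u = sym (trans (*-assoc u z _) (trans (*-congˡ (⁻¹-inverseʳ z≉0)) (*-identityʳ u)))

  fromℕ-nonneg : ∀ k → 0# ≤ fromℕ k
  fromℕ-nonneg zero    = inj₂ refl
  fromℕ-nonneg (suc k) = +-nonneg (inj₁ 0<1) (fromℕ-nonneg k)

  fromℤ-pos : ∀ {i} → ℤ.0ℤ ℤ.< i → 0# < fromℤ i
  fromℤ-pos {+ suc k} _ = +-pos-nonneg 0<1 (fromℕ-nonneg k)
  fromℤ-pos {+ zero} (ℤ.+<+ ())

  fromℤ-nonneg : ∀ {i} → ℤ.0ℤ ℤ.≤ i → 0# ≤ fromℤ i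
  fromℤ-nonneg {+ k} _ = fromℕ-nonneg k

  fromℤ-neg⁻ : ∀ {i} → i ℤ.< ℤ.0ℤ → fromℤ i < 0#
  fromℤ-neg⁻ { -[1+ k ] } ℤ.-<+ =
    0<-⇒<0 (<-respʳ-≈ (sym (⁻¹-involutive _)) (fromℤ-pos {+ suc k} (ℤ.+<+ (ℕ.s≤s ℕ.z≤n))))
  fromℤ-neg⁻ {+ k} (ℤ.+<+ ())

  fromℤ-nonpos : ∀ {i} → i ℤ.≤ ℤ.0ℤ → fromℤ i ≤ 0#
  fromℤ-nonpos {+ zero}    _ = inj₂ refl
  fromℤ-nonpos { -[1+ k ] } _ = inj₁ (fromℤ-neg⁻ {i = -[1+ k ]} ℤ.-<+)
  fromℤ-nonpos {+ suc k} (ℤ.+≤+ ())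

  fromℤ≈0⇒≡0 : ∀ i → fromℤ i ≈ 0# → i ≡ ℤ.0ℤ
  fromℤ≈0⇒≡0 (+ zero)  _  = ≡.refl
  fromℤ≈0⇒≡0 (+ suc k) eq = contradiction eq (<⇒≉ (fromℤ-pos {+ suc k} (ℤ.+<+ (ℕ.s≤s ℕ.z≤n))))
  fromℤ≈0⇒≡0 -[1+ k ]  eq = contradiction (fromℤ-neg⁻ {i = -[1+ k ]} ℤ.-<+) (irrefl eq)

  -- The order forces characteristic zero, since positive integers have positive images.
  fromℤ-injective : ∀ {i j} → fromℤ i ≈ fromℤ j → i ≡ j
  fromℤ-injective {i} {j} eq = ℤ.i-j≡0⇒i≡j i j (fromℤ≈0⇒≡0 _ (begin
    fromℤ (i ℤ.- j)        ≈⟨ fromℤ-+ i (ℤ.- j) ⟩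
    fromℤ i + fromℤ (ℤ.- j) ≈⟨ +-cong eq (fromℤ-neg j) ⟩
    fromℤ j + - fromℤ j    ≈⟨ -‿inverseʳ _ ⟩
    0#                     ∎))

-- Linear combinations, pairings and reflections

module EuclideanSpaceProperties {c ℓ₁ ℓ₂ m ℓm} {K : OrderedField c ℓ₁ ℓ₂}
                                (E : EuclideanSpace K m ℓm) where
  open OrderedField K
  open EuclideanSpace E
  open OrderedFieldProperties K
  open LeftModuleProperties leftModule using (inverseˡ-uniqueᴹ)
  open SemiringSum semiring using (sum-cong-≋) renaming (sum to ∑)
  open Solver using (solve; _:=_; _:+_; _:*_; :-_)
  private
    module ∑ᴹ = CommutativeMonoidSum +ᴹ-commutativeMonoid
    module At = IndicatorSums +ᴹ-commutativeMonoid

  0*ₗ≈0 : ∀ {a} x → a ≈ 0# → a *ₗ x ≈ᴹ 0ᴹ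
  0*ₗ≈0 x a≈0 = ≈ᴹ-trans (*ₗ-congʳ a≈0) (*ₗ-zeroˡ x)

  -ᴹ-*ₗ : ∀ a x → -ᴹ (a *ₗ x) ≈ᴹ (- a) *ₗ x
  -ᴹ-*ₗ a x = ≈ᴹ-sym (inverseˡ-uniqueᴹ _ _
    (≈ᴹ-trans (≈ᴹ-sym (*ₗ-distribʳ x (- a) a)) (0*ₗ≈0 x (-‿inverseˡ a))))

  +*ₗ-+*ₗ : ∀ x a b y → (x +ᴹ a *ₗ y) +ᴹ b *ₗ y ≈ᴹ x +ᴹ (a + b) *ₗ y
  +*ₗ-+*ₗ x a b y = ≈ᴹ-trans (+ᴹ-assoc x _ _) (+ᴹ-congˡ (≈ᴹ-sym (*ₗ-distribʳ y a b)))

  +*ₗ-cancel : ∀ x a y → (x +ᴹ a *ₗ y) +ᴹ (- a) *ₗ y ≈ᴹ x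
  +*ₗ-cancel x a y = ≈ᴹ-trans (+*ₗ-+*ₗ x a (- a) y)
    (≈ᴹ-trans (+ᴹ-congˡ (0*ₗ≈0 y (-‿inverseʳ a))) (+ᴹ-identityʳ x))

  +*ₗ-cancelʳ : ∀ x a y → (x +ᴹ (- a) *ₗ y) +ᴹ a *ₗ y ≈ᴹ x
  +*ₗ-cancelʳ x a y = ≈ᴹ-trans (+*ₗ-+*ₗ x (- a) a y)
    (≈ᴹ-trans (+ᴹ-congˡ (0*ₗ≈0 y (-‿inverseˡ a))) (+ᴹ-identityʳ x))

  *ₗ-∑ : ∀ {n} a (x : Fin n → Carrierᴹ) → a *ₗ ∑ᴹ.sum x ≈ᴹ ∑ᴹ.sum λ j → a *ₗ x j
  *ₗ-∑ {zero}  a x = *ₗ-zeroʳ a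
  *ₗ-∑ {suc n} a x = ≈ᴹ-trans (*ₗ-distribˡ a _ _) (+ᴹ-congˡ (*ₗ-∑ a (x ∘ suc)))

  linComb-cong : ∀ {n k l} (v : Fin n → Carrierᴹ) → (∀ j → k j ≈ l j) →
                 linComb k v ≈ᴹ linComb l v
  linComb-cong v k≈l = ∑ᴹ.sum-cong-≋ λ j → *ₗ-congʳ (k≈l j)

  linComb-+ : ∀ {n} k l (v : Fin n → Carrierᴹ) →
              linComb (λ j → k j + l j) v ≈ᴹ linComb k v +ᴹ linComb l v
  linComb-+ k l v = ≈ᴹ-trans (∑ᴹ.sum-cong-≋ λ j → *ₗ-distribʳ (v j) (k j) (l j))
                             (∑ᴹ.∑-distrib-+ (λ j → k j *ₗ v j) (λ j → l j *ₗ v j))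

  linComb-* : ∀ {n} a k (v : Fin n → Carrierᴹ) →
              linComb (λ j → a * k j) v ≈ᴹ a *ₗ linComb k v
  linComb-* a k v = ≈ᴹ-trans (∑ᴹ.sum-cong-≋ λ j → *ₗ-assoc a (k j) (v j))
                             (≈ᴹ-sym (*ₗ-∑ a (λ j → k j *ₗ v j)))

  δ : ∀ {n} → Fin n → Fin n → Carrier
  δ i j = if does (j Fin.≟ i) then 1# else 0#

  linComb-0 : ∀ {n} (v : Fin n → Carrierᴹ) → linComb (λ _ → 0#) v ≈ᴹ 0ᴹ
  linComb-0 {n} v = ≈ᴹ-trans (∑ᴹ.sum-cong-≋ λ j → *ₗ-zeroˡ (v j)) (∑ᴹ.sum-replicate-zero n)

  linComb-δ : ∀ {n} i (v : Fin n → Carrierᴹ) → linComb (δ i) v ≈ᴹ v i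
  linComb-δ i v = ≈ᴹ-trans (∑ᴹ.sum-cong-≋ (λ j → step (does (j Fin.≟ i)) j)) (At.∑-at i v)
    where
    step : ∀ b j → (if b then 1# else 0#) *ₗ v j ≈ᴹ (if b then v j else 0ᴹ)
    step true  j = *ₗ-identityˡ (v j)
    step false j = *ₗ-zeroˡ (v j)

  linComb-+δ : ∀ {n} k a i (v : Fin n → Carrierᴹ) →
               linComb (λ j → k j + a * δ i j) v ≈ᴹ linComb k v +ᴹ a *ₗ v i
  linComb-+δ k a i v = ≈ᴹ-trans (linComb-+ k _ v)
    (+ᴹ-congˡ (≈ᴹ-trans (linComb-* a (δ i) v) (*ₗ-congˡ (linComb-δ i v))))

  ⟨⟩-congˡ : ∀ {x y z} → x ≈ᴹ y → ⟨ x , z ⟩ ≈ ⟨ y , z ⟩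
  ⟨⟩-congˡ eq = ⟨⟩-cong eq ≈ᴹ-refl

  ⟨⟩-congʳ : ∀ {x y z} → y ≈ᴹ z → ⟨ x , y ⟩ ≈ ⟨ x , z ⟩
  ⟨⟩-congʳ eq = ⟨⟩-cong ≈ᴹ-refl eq

  ⟨⟩-+ʳ : ∀ x y z → ⟨ x , y +ᴹ z ⟩ ≈ ⟨ x , y ⟩ + ⟨ x , z ⟩
  ⟨⟩-+ʳ x y z = trans (⟨⟩-sym x _)
    (trans (⟨⟩-+ˡ y z x) (+-cong (⟨⟩-sym y x) (⟨⟩-sym z x)))

  ⟨⟩-*ʳ : ∀ a x y → ⟨ x , a *ₗ y ⟩ ≈ a * ⟨ x , y ⟩
  ⟨⟩-*ʳ a x y = trans (⟨⟩-sym x _) (trans (⟨⟩-*ˡ a y x) (*-congˡ (⟨⟩-sym y x)))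

  ⟨⟩-0ʳ : ∀ x → ⟨ x , 0ᴹ ⟩ ≈ 0#
  ⟨⟩-0ʳ x = trans (⟨⟩-congʳ (≈ᴹ-sym (*ₗ-zeroˡ 0ᴹ))) (trans (⟨⟩-*ʳ 0# x 0ᴹ) (zeroˡ _))

  ⟨⟩-+*ˡ : ∀ x a y z → ⟨ x +ᴹ a *ₗ y , z ⟩ ≈ ⟨ x , z ⟩ + a * ⟨ y , z ⟩
  ⟨⟩-+*ˡ x a y z = trans (⟨⟩-+ˡ x _ z) (+-congˡ (⟨⟩-*ˡ a y z))

  ⟨⟩-+*ʳ : ∀ x y a z → ⟨ x , y +ᴹ a *ₗ z ⟩ ≈ ⟨ x , y ⟩ + a * ⟨ x , z ⟩
  ⟨⟩-+*ʳ x y a z = trans (⟨⟩-+ʳ x y _) (+-congˡ (⟨⟩-*ʳ a x z))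

  ⟨⟩-linCombʳ : ∀ {n} x k (v : Fin n → Carrierᴹ) →
                ⟨ x , linComb k v ⟩ ≈ ∑ λ j → k j * ⟨ x , v j ⟩
  ⟨⟩-linCombʳ {zero}  x k v = ⟨⟩-0ʳ x
  ⟨⟩-linCombʳ {suc n} x k v = trans (⟨⟩-+ʳ x _ _)
    (+-cong (⟨⟩-*ʳ (k zero) x (v zero)) (⟨⟩-linCombʳ x (k ∘ suc) (v ∘ suc)))

  ⟨⟩-linCombˡ : ∀ {n} k (v : Fin n → Carrierᴹ) x →
                ⟨ linComb k v , x ⟩ ≈ ∑ λ j → k j * ⟨ v j , x ⟩
  ⟨⟩-linCombˡ k v x = trans (⟨⟩-sym _ x)
    (trans (⟨⟩-linCombʳ x k v) (sum-cong-≋ λ j → *-congˡ (⟨⟩-sym x (v j))))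

  reflect-+*ₗ : ∀ α x → reflect α x ≈ᴹ x +ᴹ (- ⟨ x , α ᵛ ⟩) *ₗ α
  reflect-+*ₗ α x = +ᴹ-congˡ (-ᴹ-*ₗ ⟨ x , α ᵛ ⟩ α)

  reflect-cong : ∀ α {x y} → x ≈ᴹ y → reflect α x ≈ᴹ reflect α y
  reflect-cong α eq = +ᴹ-cong eq (-ᴹ‿cong (*ₗ-congʳ (⟨⟩-congˡ eq)))

  module _ {α} (α≉0 : α ≉ᴹ 0ᴹ) where
    norm≉0 : ⟨ α , α ⟩ ≉ 0#
    norm≉0 = <⇒≉ (⟨⟩-positive α≉0)

    coroot-scale-pos : 0# < 2# * ⟨ α , α ⟩ ⁻¹
    coroot-scale-pos = *-pos 0<2 (⁻¹-pos (⟨⟩-positive α≉0))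

    ⟨α,αᵛ⟩≈2 : ⟨ α , α ᵛ ⟩ ≈ 2#
    ⟨α,αᵛ⟩≈2 = trans (⟨⟩-*ʳ _ α α)
      (trans (*-assoc 2# _ _) (trans (*-congˡ (⁻¹-inverseˡ norm≉0)) (*-identityʳ 2#)))

    ⟨reflect,αᵛ⟩ : ∀ x → ⟨ reflect α x , α ᵛ ⟩ ≈ - ⟨ x , α ᵛ ⟩
    ⟨reflect,αᵛ⟩ x = begin
      ⟨ reflect α x , α ᵛ ⟩                ≈⟨ ⟨⟩-congˡ (reflect-+*ₗ α x) ⟩
      ⟨ x +ᴹ (- a) *ₗ α , α ᵛ ⟩            ≈⟨ ⟨⟩-+*ˡ x (- a) α (α ᵛ) ⟩
      a + (- a) * ⟨ α , α ᵛ ⟩              ≈⟨ +-congˡ (*-congˡ ⟨α,αᵛ⟩≈2) ⟩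
      a + (- a) * (1# + 1#)                ≈⟨ +-congˡ (trans (distribˡ _ 1# 1#)
                                                (+-cong (*-identityʳ _) (*-identityʳ _))) ⟩
      a + (- a + - a)                      ≈⟨ solve 1 (λ a → a :+ (:- a :+ :- a) := :- a) refl a ⟩
      - a                                  ∎
      where
      open SetoidReasoning setoid
      a = ⟨ x , α ᵛ ⟩

    reflect-involutive : ∀ x → reflect α (reflect α x) ≈ᴹ x
    reflect-involutive x = begin
      reflect α (reflect α x)
        ≈⟨ reflect-+*ₗ α _ ⟩
      reflect α x +ᴹ (- ⟨ reflect α x , α ᵛ ⟩) *ₗ α
        ≈⟨ +ᴹ-cong (reflect-+*ₗ α x) (*ₗ-congʳ (-‿cong (⟨reflect,αᵛ⟩ x))) ⟩
      (x +ᴹ (- ⟨ x , α ᵛ ⟩) *ₗ α) +ᴹ (- - ⟨ x , α ᵛ ⟩) *ₗ α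
        ≈⟨ +*ₗ-cancel x _ α ⟩
      x ∎
      where open SetoidReasoning ≈ᴹ-setoid

    -- The coroot is scaled by the norm, so invariance of the norm is what lets reflections commute
    -- with passing to coroots in `reflect-ᵛ`.
    reflect-isometric : ∀ x → ⟨ reflect α x , reflect α x ⟩ ≈ ⟨ x , x ⟩
    reflect-isometric x = begin
      ⟨ reflect α x , reflect α x ⟩
        ≈⟨ ⟨⟩-congʳ (reflect-+*ₗ α x) ⟩
      ⟨ reflect α x , x +ᴹ (- a) *ₗ α ⟩
        ≈⟨ ⟨⟩-+*ʳ _ x (- a) α ⟩
      ⟨ reflect α x , x ⟩ + (- a) * ⟨ reflect α x , α ⟩
        ≈⟨ +-cong (trans (⟨⟩-congˡ (reflect-+*ₗ α x)) (⟨⟩-+*ˡ x (- a) α x))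
                  (*-congˡ ⟨reflect,α⟩) ⟩
      (⟨ x , x ⟩ + (- a) * ⟨ α , x ⟩) + (- a) * (- ⟨ x , α ⟩)
        ≈⟨ +-congˡ (*-congˡ (-‿cong (⟨⟩-sym x α))) ⟩
      (⟨ x , x ⟩ + (- a) * ⟨ α , x ⟩) + (- a) * (- ⟨ α , x ⟩)
        ≈⟨ solve 3 (λ q a p → (q :+ :- a :* p) :+ :- a :* :- p := q) refl ⟨ x , x ⟩ a ⟨ α , x ⟩ ⟩
      ⟨ x , x ⟩ ∎
      where
      open SetoidReasoning setoid
      t = 2# * ⟨ α , α ⟩ ⁻¹
      a = ⟨ x , α ᵛ ⟩
      ⟨reflect,α⟩ : ⟨ reflect α x , α ⟩ ≈ - ⟨ x , α ⟩
      ⟨reflect,α⟩ = *-cancelʳ (<⇒≉ coroot-scale-pos) (begin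
        ⟨ reflect α x , α ⟩ * t  ≈⟨ *-comm _ t ⟩
        t * ⟨ reflect α x , α ⟩  ≈⟨ sym (⟨⟩-*ʳ t _ α) ⟩
        ⟨ reflect α x , α ᵛ ⟩    ≈⟨ ⟨reflect,αᵛ⟩ x ⟩
        - ⟨ x , α ᵛ ⟩            ≈⟨ -‿cong (⟨⟩-*ʳ t x α) ⟩
        - (t * ⟨ x , α ⟩)        ≈⟨ solve 2 (λ t p → :- (t :* p) := :- p :* t) refl t ⟨ x , α ⟩ ⟩
        - ⟨ x , α ⟩ * t          ∎)

  ᵛ-cong : ∀ {x y} → x ≉ᴹ 0ᴹ → x ≈ᴹ y → x ᵛ ≈ᴹ y ᵛ
  ᵛ-cong x≉0 x≈y = *ₗ-cong (*-congˡ (⁻¹-cong (norm≉0 x≉0) (⟨⟩-cong x≈y x≈y))) x≈y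

  -- With coroot scales t of α and u of x, both u⟨x, αᵛ⟩α and ⟨α, xᵛ⟩αᵛ equal ut⟨x, α⟩α. The
  -- right-hand form is the reflection of the dual root system, so for simple α it changes only one
  -- coroot coordinate.
  reflect-ᵛ : ∀ {α x} → α ≉ᴹ 0ᴹ → x ≉ᴹ 0ᴹ →
              reflect α x ᵛ ≈ᴹ x ᵛ +ᴹ (- ⟨ α , x ᵛ ⟩) *ₗ α ᵛ
  reflect-ᵛ {α} {x} α≉0 x≉0 = begin
    reflect α x ᵛ
      -- The double symmetry is due to `⁻¹-cong`, which asks for the norm of x, rather than that of
      -- its reflection, to be nonzero.
      ≈⟨ *ₗ-cong (*-congˡ (sym (⁻¹-cong (norm≉0 x≉0) (sym (reflect-isometric α≉0 x)))))
                 (reflect-+*ₗ α x) ⟩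
    u *ₗ (x +ᴹ (- ⟨ x , α ᵛ ⟩) *ₗ α)
      ≈⟨ *ₗ-distribˡ u x _ ⟩
    x ᵛ +ᴹ u *ₗ ((- ⟨ x , α ᵛ ⟩) *ₗ α)
      ≈⟨ +ᴹ-congˡ (≈ᴹ-trans (≈ᴹ-sym (*ₗ-assoc u _ α))
                    (≈ᴹ-trans (*ₗ-congʳ scalars) (*ₗ-assoc _ t α))) ⟩
    x ᵛ +ᴹ (- ⟨ α , x ᵛ ⟩) *ₗ α ᵛ ∎
    where
    t = 2# * ⟨ α , α ⟩ ⁻¹
    u = 2# * ⟨ x , x ⟩ ⁻¹
    scalars : u * (- ⟨ x , α ᵛ ⟩) ≈ (- ⟨ α , x ᵛ ⟩) * t
    scalars = begin
      u * (- ⟨ x , α ᵛ ⟩)        ≈⟨ *-congˡ (-‿cong (⟨⟩-*ʳ t x α)) ⟩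
      u * (- (t * ⟨ x , α ⟩))    ≈⟨ *-congˡ (-‿cong (*-congˡ (⟨⟩-sym x α))) ⟩
      u * (- (t * ⟨ α , x ⟩))    ≈⟨ solve 3 (λ u t p → u :* :- (t :* p) := :- (u :* p) :* t)
                                      refl u t ⟨ α , x ⟩ ⟩
      (- (u * ⟨ α , x ⟩)) * t    ≈⟨ *-congʳ (-‿cong (sym (⟨⟩-*ʳ u α x))) ⟩
      (- ⟨ α , x ᵛ ⟩) * t        ∎
      where open SetoidReasoning setoid
    open SetoidReasoning ≈ᴹ-setoid

-- Sums over decidable subsets

module SumOver {a ℓ} (M : CommutativeMonoid a ℓ) {n p} {P : Pred (Fin n) p}
               (P? : Decidable P) where
  open CommutativeMonoid M
  open CommutativeMonoidSum M using (sum-cong-≋; sum-replicate-zero)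

  sumOver-cong : ∀ {x y} → (∀ i → P i → x i ≈ y i) →
                 sumOver rawMonoid P? x ≈ sumOver rawMonoid P? y
  sumOver-cong {x} {y} x≈y = sum-cong-≋ step
    where
    step : ∀ i → (if does (P? i) then x i else ε) ≈ (if does (P? i) then y i else ε)
    step i with P? i
    ... | yes p = x≈y i p
    ... | no  _ = refl

  sumOver-ε : ∀ {x} → (∀ i → P i → x i ≈ ε) → sumOver rawMonoid P? x ≈ ε
  sumOver-ε {x} x≈ε = trans (sum-cong-≋ step) (sum-replicate-zero n)
    where
    step : ∀ i → (if does (P? i) then x i else ε) ≈ ε
    step i with P? i
    ... | yes p = x≈ε i p
    ... | no  _ = refl

  sumOver-∖ : ∀ {q} {Q : Pred (Fin n) q} (Q? : Decidable Q) {x} → (∀ i → P i → Q i → x i ≈ ε) →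
              sumOver rawMonoid P? x ≈ sumOver rawMonoid (λ i → P? i ×-dec ¬? (Q? i)) x
  sumOver-∖ Q? {x} x≈ε = sum-cong-≋ step
    where
    step : ∀ i → (if does (P? i) then x i else ε)
               ≈ (if does (P? i ×-dec ¬? (Q? i)) then x i else ε)
    step i with P? i | Q? i
    ... | yes p | yes q = x≈ε i p q
    ... | yes _ | no  _ = refl
    ... | no  _ | _     = refl

-- Simple reflections and the positive coroots

module SimpleReflections {c ℓ₁ ℓ₂ m ℓm} {K : OrderedField c ℓ₁ ℓ₂} {E : EuclideanSpace K m ℓm}
                         {Φ : RootSystem E} {n} (Δ : Base Φ n) where
  open OrderedField K
  open EuclideanSpace E
  open RootSystem Φ
  open Base Δ
  open Coroots Δ
  open OrderedFieldProperties K
  open EuclideanSpaceProperties E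
  open SemiringSum semiring using (sum-cong-≋; ∑-distrib-+; *-distribˡ-sum) renaming (sum to ∑)
  open GroupProperties +-group using (⁻¹-involutive)
  open Solver using (solve; _:=_; _:+_; _:*_; :-_)
  private
    module At = IndicatorSums +-commutativeMonoid

  -- Acting on indices instead of vectors makes s_v a permutation along which finite sums can be
  -- reindexed, and makes equality of roots decidable.
  σ : Fin n → Fin size → Fin size
  σ v r = proj₁ (reflect-closed (simple v) r)

  root-σ : ∀ v r → root (σ v r) ≈ᴹ root r +ᴹ (- ⟨ root r , αᵛ v ⟩) *ₗ α v
  root-σ v r = ≈ᴹ-trans (proj₂ (reflect-closed (simple v) r)) (reflect-+*ₗ (α v) (root r))

  coroot-σ : ∀ v r → coroot (σ v r) ≈ᴹ coroot r +ᴹ (- ⟨ α v , coroot r ⟩) *ₗ αᵛ v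
  coroot-σ v r = ≈ᴹ-trans (ᵛ-cong (nonzero (σ v r)) (proj₂ (reflect-closed (simple v) r)))
                          (reflect-ᵛ (nonzero (simple v)) (nonzero r))

  σ-involutive : ∀ v r → σ v (σ v r) ≡ r
  σ-involutive v r = root-injective (begin
    root (σ v (σ v r))                     ≈⟨ proj₂ (reflect-closed (simple v) (σ v r)) ⟩
    reflect (α v) (root (σ v r))           ≈⟨ reflect-cong (α v) (proj₂ (reflect-closed (simple v) r)) ⟩
    reflect (α v) (reflect (α v) (root r)) ≈⟨ reflect-involutive (nonzero (simple v)) (root r) ⟩
    root r                                 ∎)
    where open SetoidReasoning ≈ᴹ-setoid

  coefficient-simple : ∀ v j → coefficient (simple v) j ≈ δ v j
  coefficient-simple v j =
    sym (coefficient-unique (simple v) (δ v) (≈ᴹ-sym (linComb-δ v αᵛ)) j)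

  coefficient-σ : ∀ v r j →
    coefficient (σ v r) j ≈ coefficient r j + (- ⟨ α v , coroot r ⟩) * δ v j
  coefficient-σ v r j = sym (coefficient-unique (σ v r) _ (begin
    coroot (σ v r)
      ≈⟨ coroot-σ v r ⟩
    coroot r +ᴹ (- ⟨ α v , coroot r ⟩) *ₗ αᵛ v
      ≈⟨ +ᴹ-congʳ (proj₂ (coroot-expansion r)) ⟩
    linComb (coefficient r) αᵛ +ᴹ (- ⟨ α v , coroot r ⟩) *ₗ αᵛ v
      ≈⟨ linComb-+δ (coefficient r) _ v αᵛ ⟨
    linComb (λ i → coefficient r i + (- ⟨ α v , coroot r ⟩) * δ v i) αᵛ ∎) j)
    where open SetoidReasoning ≈ᴹ-setoid

  δ-refl : ∀ (v : Fin n) → δ v v ≈ 1#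
  δ-refl v with v Fin.≟ v
  ... | yes _ = refl
  ... | no ¬p = contradiction ≡.refl ¬p

  δ-≢ : ∀ {v j : Fin n} → j ≢ v → δ v j ≈ 0#
  δ-≢ {v} {j} j≢v with j Fin.≟ v
  ... | yes p = contradiction p j≢v
  ... | no  _ = refl

  coefficient-σ-≢ : ∀ {v r j} → j ≢ v → coefficient (σ v r) j ≈ coefficient r j
  coefficient-σ-≢ {v} {r} {j} j≢v = trans (coefficient-σ v r j)
    (trans (+-congˡ (trans (*-congˡ (δ-≢ j≢v)) (zeroʳ _))) (+-identityʳ _))

  module _ (r : Fin size) where
    private
      q = ⟨ root r , root r ⟩

    corootScale corootScale⁻¹ : Carrier
    corootScale   = 2# * q ⁻¹
    corootScale⁻¹ = q * 2# ⁻¹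

    corootScale-pos : 0# < corootScale
    corootScale-pos = coroot-scale-pos (nonzero r)

    corootScale⁻¹-pos : 0# < corootScale⁻¹
    corootScale⁻¹-pos = *-pos (⟨⟩-positive (nonzero r)) (⁻¹-pos 0<2)

    corootScale⁻¹-inverse : corootScale⁻¹ * corootScale ≈ 1#
    corootScale⁻¹-inverse = begin
      (q * 2# ⁻¹) * (2# * q ⁻¹)
        ≈⟨ solve 4 (λ q h t i → (q :* h) :* (t :* i) := (h :* t) :* (q :* i))
                   refl q (2# ⁻¹) 2# (q ⁻¹) ⟩
      (2# ⁻¹ * 2#) * (q * q ⁻¹)
        ≈⟨ *-cong (⁻¹-inverseˡ (<⇒≉ 0<2)) (⁻¹-inverseʳ (norm≉0 (nonzero r))) ⟩
      1# * 1#
        ≈⟨ *-identityˡ 1# ⟩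
      1# ∎
      where open SetoidReasoning setoid

    root-from-coroot : root r ≈ᴹ corootScale⁻¹ *ₗ coroot r
    root-from-coroot = begin
      root r                                  ≈⟨ *ₗ-identityˡ _ ⟨
      1# *ₗ root r                            ≈⟨ *ₗ-congʳ corootScale⁻¹-inverse ⟨
      (corootScale⁻¹ * corootScale) *ₗ root r ≈⟨ *ₗ-assoc _ _ _ ⟩
      corootScale⁻¹ *ₗ coroot r               ∎
      where open SetoidReasoning ≈ᴹ-setoid

  -- `Positive` speaks of coroot coordinates. Rescaling those by positive factors, instead of taking
  -- the integers of `integral`, lets nonnegativity pass to the coordinates of the root at once.
  rootCoefficient : Fin size → Fin n → Carrier
  rootCoefficient r j = corootScale⁻¹ r * (coefficient r j * corootScale (simple j))

  root-expansion : ∀ r → root r ≈ᴹ linComb (rootCoefficient r) α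
  root-expansion r = begin
    root r
      ≈⟨ root-from-coroot r ⟩
    corootScale⁻¹ r *ₗ coroot r
      ≈⟨ *ₗ-congˡ (proj₂ (coroot-expansion r)) ⟩
    corootScale⁻¹ r *ₗ linComb (coefficient r) αᵛ
      ≈⟨ *ₗ-congˡ (∑ᴹ.sum-cong-≋ λ j → ≈ᴹ-sym (*ₗ-assoc (coefficient r j) _ (α j))) ⟩
    corootScale⁻¹ r *ₗ linComb (λ j → coefficient r j * corootScale (simple j)) α
      ≈⟨ linComb-* (corootScale⁻¹ r) _ α ⟨
    linComb (rootCoefficient r) α ∎
    where
    open SetoidReasoning ≈ᴹ-setoid
    module ∑ᴹ = CommutativeMonoidSum +ᴹ-commutativeMonoid

  coefficient-nonneg : ∀ {r} → Positive r → ∀ j → 0# ≤ coefficient r j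
  coefficient-nonneg {r} (k , eq , 0≤k) j = ≤-respʳ-≈ (coefficient-unique r k eq j) (0≤k j)

  rootCoefficient-nonneg : ∀ {r} → Positive r → ∀ j → 0# ≤ rootCoefficient r j
  rootCoefficient-nonneg {r} pos j = *-nonneg (<⇒≤ (corootScale⁻¹-pos r))
    (*-nonneg (coefficient-nonneg pos j) (<⇒≤ (corootScale-pos (simple j))))

  -- By the construction in `coroot-expansion`, `coefficient r j` is the integer coordinate of the
  -- root times two positive scales, so the dichotomy of `integral` carries over.
  coefficient-sign : ∀ r → (∀ j → 0# ≤ coefficient r j) ⊎ (∀ j → coefficient r j ≤ 0#)
  coefficient-sign r = Sum.map
    (λ 0≤z j → *-nonneg (<⇒≤ (corootScale-pos r))
                 (*-nonneg (fromℤ-nonneg (0≤z j)) (<⇒≤ (corootScale⁻¹-pos (simple j)))))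
    (λ z≤0 j → *-nonneg-nonpos (<⇒≤ (corootScale-pos r))
                 (≤-respˡ-≈ (*-comm _ _)
                   (*-nonneg-nonpos (<⇒≤ (corootScale⁻¹-pos (simple j))) (fromℤ-nonpos (z≤0 j)))))
    (proj₂ (proj₂ (integral r)))

  coefficient-nonpos : ∀ {r} → ¬ Positive r → ∀ j → coefficient r j ≤ 0#
  coefficient-nonpos {r} ¬pos = Sum.fromInj₂
    (λ 0≤k → contradiction (coefficient r , proj₂ (coroot-expansion r) , 0≤k) ¬pos)
    (coefficient-sign r)

  simple-positive : ∀ v → Positive (simple v)
  simple-positive v = δ v , ≈ᴹ-sym (linComb-δ v αᵛ) , λ j → δ-nonneg (does (j Fin.≟ v))
    where
    δ-nonneg : ∀ b → 0# ≤ (if b then 1# else 0#)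
    δ-nonneg true  = inj₁ 0<1
    δ-nonneg false = inj₂ refl

  -- The v-th coefficient of the image is 1 - 2 = -1.
  σ-simple-¬positive : ∀ v → ¬ Positive (σ v (simple v))
  σ-simple-¬positive v pos = ≤⇒≯ (≤-respʳ-≈ eq (coefficient-nonneg pos v)) (0<-⇒<0 -1<0)
    where
    open SetoidReasoning setoid
    -1<0 : 0# < - - 1#
    -1<0 = <-respʳ-≈ (sym (⁻¹-involutive 1#)) 0<1
    eq : coefficient (σ v (simple v)) v ≈ - 1#
    eq = begin
      coefficient (σ v (simple v)) v
        ≈⟨ coefficient-σ v (simple v) v ⟩
      coefficient (simple v) v + (- ⟨ α v , αᵛ v ⟩) * δ v v
        ≈⟨ +-cong (trans (coefficient-simple v v) (δ-refl v))
                  (*-cong (-‿cong (⟨α,αᵛ⟩≈2 (nonzero (simple v)))) (δ-refl v)) ⟩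
      1# + (- (1# + 1#)) * 1#
        ≈⟨ +-congˡ (*-identityʳ _) ⟩
      1# + (- (1# + 1#))
        ≈⟨ solve 1 (λ x → x :+ (:- (x :+ x)) := :- x) refl 1# ⟩
      - 1# ∎

  -- If s_v γ were negative, all coefficients of γ off v would vanish, and γ would be
  -- a multiple of α_v.
  σ-positive : ∀ {v r} → Positive r → r ≢ simple v → Positive (σ v r)
  σ-positive {v} {r} pos r≢v with positive? (σ v r)
  ... | yes pos′ = pos′
  ... | no ¬pos′ = contradiction (reduced (simple v) r a root≈) λ
    { (inj₁ a≈1)  → r≢v (root-injective (≈ᴹ-trans root≈ (≈ᴹ-trans (*ₗ-congʳ a≈1) (*ₗ-identityˡ _))))
    ; (inj₂ a≈-1) → ≤⇒≯ (≤-respʳ-≈ a≈-1 0≤a) (0<-⇒<0 (<-respʳ-≈ (sym (⁻¹-involutive 1#)) 0<1))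
    }
    where
    a = rootCoefficient r v
    0≤a : 0# ≤ a
    0≤a = rootCoefficient-nonneg pos v
    vanish : ∀ j → j ≢ v → coefficient r j ≈ 0#
    vanish j j≢v = ≤-antisym
      (≤-respˡ-≈ (coefficient-σ-≢ j≢v) (coefficient-nonpos ¬pos′ j))
      (coefficient-nonneg pos j)
    concentrated : ∀ j → rootCoefficient r j ≈ a * δ v j
    concentrated j with j Fin.≟ v
    ... | yes ≡.refl = sym (*-identityʳ a)
    ... | no j≢v = trans
      (trans (*-congˡ (trans (*-congʳ (vanish j j≢v)) (zeroˡ _))) (zeroʳ _))
      (sym (zeroʳ a))
    root≈ : root r ≈ᴹ a *ₗ α v
    root≈ = ≈ᴹ-trans (root-expansion r) (≈ᴹ-trans (linComb-cong α concentrated)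
      (≈ᴹ-trans (linComb-* a (δ v) α) (*ₗ-congˡ (linComb-δ v α))))

  -- `σ-positive` gives both directions. The second excluded root is -α_v, whose image α_v is
  -- positive.
  does-positive-σ : ∀ {v r} → r ≢ simple v → r ≢ σ v (simple v) →
                    does (positive? (σ v r)) ≡ does (positive? r)
  does-positive-σ {v} {r} r≢v r≢σv = does-⇔ (mk⇔ to from) (positive? (σ v r)) (positive? r)
    where
    to : Positive (σ v r) → Positive r
    to pos = ≡.subst Positive (σ-involutive v r) (σ-positive pos λ σr≡v →
      r≢σv (≡.trans (≡.sym (σ-involutive v r)) (≡.cong (σ v) σr≡v)))
    from : Positive r → Positive (σ v r)
    from pos = σ-positive pos r≢v

  -- The linear form on coroots that takes the value φ j at `αᵛ j`. It gives the pairing with x when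
  -- φ j is ⟨x, αᵛ_j⟩, and the I-height when φ is the indicator of I.
  Λ : (Fin n → Carrier) → Fin size → Carrier
  Λ φ r = ∑ λ j → coefficient r j * φ j

  Λ-cong : ∀ {φ ψ} → (∀ j → φ j ≈ ψ j) → ∀ r → Λ φ r ≈ Λ ψ r
  Λ-cong φ≈ψ r = sum-cong-≋ λ j → *-congˡ (φ≈ψ j)

  Λ-+* : ∀ φ a ψ r → Λ (λ j → φ j + a * ψ j) r ≈ Λ φ r + a * Λ ψ r
  Λ-+* φ a ψ r = begin
    Λ (λ j → φ j + a * ψ j) r
      ≈⟨ sum-cong-≋ (λ j → solve 4 (λ k p a q → k :* (p :+ a :* q) := k :* p :+ a :* (k :* q))
                                   refl (coefficient r j) (φ j) a (ψ j)) ⟩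
    ∑ (λ j → coefficient r j * φ j + a * (coefficient r j * ψ j))
      ≈⟨ ∑-distrib-+ (λ j → coefficient r j * φ j) (λ j → a * (coefficient r j * ψ j)) ⟩
    Λ φ r + ∑ (λ j → a * (coefficient r j * ψ j))
      ≈⟨ +-congˡ (*-distribˡ-sum a (λ j → coefficient r j * ψ j)) ⟨
    Λ φ r + a * Λ ψ r ∎
    where open SetoidReasoning setoid

  ∑-δ : ∀ (v : Fin n) φ → ∑ (λ j → δ v j * φ j) ≈ φ v
  ∑-δ v φ = trans (sum-cong-≋ λ j → step (does (j Fin.≟ v)) j) (At.∑-at v φ)
    where
    step : ∀ b j → (if b then 1# else 0#) * φ j ≈ (if b then φ j else 0#)
    step true  j = *-identityˡ (φ j)
    step false j = zeroˡ (φ j)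

  Λ-simple : ∀ φ v → Λ φ (simple v) ≈ φ v
  Λ-simple φ v = trans (sum-cong-≋ λ j → *-congʳ (coefficient-simple v j)) (∑-δ v φ)

  Λ-σ : ∀ φ v r → Λ φ (σ v r) ≈ Λ φ r + (- ⟨ α v , coroot r ⟩) * φ v
  Λ-σ φ v r = begin
    Λ φ (σ v r)
      ≈⟨ sum-cong-≋ (λ j → trans (*-congʳ (coefficient-σ v r j))
           (solve 4 (λ k b d p → (k :+ b :* d) :* p := k :* p :+ b :* (d :* p))
                  refl (coefficient r j) b (δ v j) (φ j))) ⟩
    ∑ (λ j → coefficient r j * φ j + b * (δ v j * φ j))
      ≈⟨ ∑-distrib-+ (λ j → coefficient r j * φ j) (λ j → b * (δ v j * φ j)) ⟩
    Λ φ r + ∑ (λ j → b * (δ v j * φ j))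
      ≈⟨ +-congˡ (*-distribˡ-sum b (λ j → δ v j * φ j)) ⟨
    Λ φ r + b * ∑ (λ j → δ v j * φ j)
      ≈⟨ +-congˡ (*-congˡ (∑-δ v φ)) ⟩
    Λ φ r + b * φ v ∎
    where
    open SetoidReasoning setoid
    b = - ⟨ α v , coroot r ⟩

  Λ-⟨⟩ : ∀ x r → Λ (λ j → ⟨ x , αᵛ j ⟩) r ≈ ⟨ x , coroot r ⟩
  Λ-⟨⟩ x r = sym (trans (⟨⟩-congʳ (proj₂ (coroot-expansion r)))
                        (⟨⟩-linCombʳ x (coefficient r) αᵛ))

  Λ-nonneg : ∀ {φ r} → Positive r → (∀ j → 0# ≤ φ j) → 0# ≤ Λ φ r
  Λ-nonneg pos 0≤φ = ∑-nonneg λ j → *-nonneg (coefficient-nonneg pos j) (0≤φ j)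

  -- Positivity changes under s_v exactly at α_v and -α_v. Putting their terms on opposite sides
  -- replaces subtraction, so one statement serves both counts in ℕ and sums in the field.
  positiveSum-σ : ∀ {a ℓ} (M : CommutativeMonoid a ℓ) v g →
    let open CommutativeMonoid M using (_∙_; rawMonoid) renaming (_≈_ to _≋_) in
    (sumOver rawMonoid positive? (g ∘ σ v) ∙ g (simple v))
      ≋ (sumOver rawMonoid positive? g ∙ g (σ v (simple v)))
  positiveSum-σ M v = IndicatorSums.∑-involution M (λ r → does (positive? r)) (σ v) (σ-involutive v)
    (dec-true (positive? _) (simple-positive v))
    (dec-false (positive? _) (σ-simple-¬positive v))
    (λ _ → does-positive-σ)

-- T is the linear action recentred at the point ω with ⟨ω, αᵛ_v⟩ = ε_v; working with
-- levels avoids constructing ω.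
module AffineReflections {c ℓ₁ ℓ₂ m ℓm} {K : OrderedField c ℓ₁ ℓ₂} {E : EuclideanSpace K m ℓm}
                         {Φ : RootSystem E} {n} (Δ : Base Φ n)
                         (ε : Fin n → OrderedField.Carrier K) where
  open OrderedField K
  open EuclideanSpace E
  open RootSystem Φ
  open Base Δ
  open Coroots Δ
  open OrderedFieldProperties K
  open EuclideanSpaceProperties E
  open SimpleReflections Δ
  open GroupProperties +-group using (ε⁻¹≈ε)
  open Solver using (solve; _:=_; _:+_; _:*_; :-_)

  -- The affine action and its effect on levels

  level : Carrierᴹ → Fin size → Carrier
  level x r = Λ (λ j → ⟨ x , αᵛ j ⟩ + - ε j) r

  T : Fin n → Carrierᴹ → Carrierᴹ
  T v x = x +ᴹ (- level x (simple v)) *ₗ α v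

  level-simple : ∀ x v → level x (simple v) ≈ ⟨ x , αᵛ v ⟩ + - ε v
  level-simple x v = Λ-simple _ v

  level-cong : ∀ {x y} → x ≈ᴹ y → ∀ r → level x r ≈ level y r
  level-cong x≈y = Λ-cong λ j → +-congʳ (⟨⟩-congˡ x≈y)

  level-+* : ∀ x a y r → level (x +ᴹ a *ₗ y) r ≈ level x r + a * ⟨ y , coroot r ⟩
  level-+* x a y r = begin
    level (x +ᴹ a *ₗ y) r
      ≈⟨ Λ-cong (λ j → trans (+-congʳ (⟨⟩-+*ˡ x a y (αᵛ j)))
           (solve 4 (λ p a q e → (p :+ a :* q) :+ :- e := (p :+ :- e) :+ a :* q)
                  refl ⟨ x , αᵛ j ⟩ a ⟨ y , αᵛ j ⟩ (ε j))) r ⟩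
    Λ (λ j → (⟨ x , αᵛ j ⟩ + - ε j) + a * ⟨ y , αᵛ j ⟩) r
      ≈⟨ Λ-+* (λ j → ⟨ x , αᵛ j ⟩ + - ε j) a (λ j → ⟨ y , αᵛ j ⟩) r ⟩
    level x r + a * Λ (λ j → ⟨ y , αᵛ j ⟩) r
      ≈⟨ +-congˡ (*-congˡ (Λ-⟨⟩ y r)) ⟩
    level x r + a * ⟨ y , coroot r ⟩ ∎
    where open SetoidReasoning setoid

  level-0 : ∀ r → level 0ᴹ r ≈ - Λ ε r
  level-0 r = begin
    level 0ᴹ r
      ≈⟨ Λ-cong (λ j → trans (+-congʳ (trans (⟨⟩-sym _ _) (⟨⟩-0ʳ (αᵛ j))))
                             (+-congˡ (sym (-1*x≈-x (ε j))))) r ⟩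
    Λ (λ j → 0# + - 1# * ε j) r
      ≈⟨ Λ-+* (λ _ → 0#) (- 1#) ε r ⟩
    Λ (λ _ → 0#) r + - 1# * Λ ε r
      ≈⟨ +-cong Λ-0 (-1*x≈-x _) ⟩
    0# + - Λ ε r
      ≈⟨ +-identityˡ _ ⟩
    - Λ ε r ∎
    where
    open SetoidReasoning setoid
    open RingProperties ring using (-1*x≈-x)
    Λ-0 : Λ (λ _ → 0#) r ≈ 0#
    Λ-0 = trans (sum-cong-≋ λ j → zeroʳ (coefficient r j)) (sum-replicate-zero n)
      where open SemiringSum semiring using (sum-cong-≋; sum-replicate-zero)

  level-σ : ∀ x v r →
            level x (σ v r) ≈ level x r + (- ⟨ α v , coroot r ⟩) * level x (simple v)
  level-σ x v r = trans (Λ-σ _ v r) (+-congˡ (*-congˡ (sym (level-simple x v))))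

  -- Both sides are `level x r` minus ⟨α_v, γᵛ⟩ times the level at α_v: on the left the point has
  -- moved along α_v, on the right the coroot along αᵛ_v.
  level-T : ∀ v x r → level (T v x) r ≈ level x (σ v r)
  level-T v x r = trans (level-+* x _ (α v) r)
    (trans (+-congˡ (solve 2 (λ l p → :- l :* p := :- p :* l) refl
                             (level x (simple v)) ⟨ α v , coroot r ⟩))
           (sym (level-σ x v r)))

  level-σ-simple : ∀ x v → level x (σ v (simple v)) ≈ - level x (simple v)
  level-σ-simple x v = begin
    level x (σ v (simple v))   ≈⟨ level-σ x v (simple v) ⟩
    l + (- ⟨ α v , αᵛ v ⟩) * l ≈⟨ +-congˡ (*-congʳ (-‿cong (⟨α,αᵛ⟩≈2 (nonzero (simple v))))) ⟩
    -- The solver's numeral one denotes `1# + 0#`, so `1#` enters as a variable and is removed by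
    -- the identity law afterwards.
    l + (- (1# + 1#)) * l      ≈⟨ solve 2 (λ l o → l :+ :- (o :+ o) :* l := l :+ :- (o :* l :+ o :* l))
                                        refl l 1# ⟩
    l + - (1# * l + 1# * l)    ≈⟨ +-congˡ (-‿cong (+-cong (*-identityˡ l) (*-identityˡ l))) ⟩
    l + - (l + l)              ≈⟨ solve 1 (λ l → l :+ :- (l :+ l) := :- l) refl l ⟩
    - l                        ∎
    where
    open SetoidReasoning setoid
    l = level x (simple v)

  T-cong : ∀ v {x y} → x ≈ᴹ y → T v x ≈ᴹ T v y
  T-cong v x≈y = +ᴹ-cong x≈y (*ₗ-congʳ (-‿cong (level-cong x≈y (simple v))))

  T-involutive : ∀ v x → T v (T v x) ≈ᴹ x
  T-involutive v x = ≈ᴹ-trans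
    (+ᴹ-congˡ (*ₗ-congʳ (-‿cong (trans (level-T v x (simple v)) (level-σ-simple x v)))))
    (+*ₗ-cancel x _ (α v))

  -- `T v` is affine with linear part s_v. Translations along roots are all that the words below
  -- require, and on roots s_v is `σ v`.
  T-+root : ∀ v x a r → T v (x +ᴹ a *ₗ root r) ≈ᴹ T v x +ᴹ a *ₗ root (σ v r)
  T-+root v x a r = begin
    (x +ᴹ a *ₗ root r) +ᴹ (- level (x +ᴹ a *ₗ root r) (simple v)) *ₗ α v
      ≈⟨ +ᴹ-congˡ (≈ᴹ-trans (*ₗ-congʳ scalars) (*ₗ-distribʳ (α v) _ _)) ⟩
    (x +ᴹ a *ₗ root r) +ᴹ ((- l) *ₗ α v +ᴹ (a * (- p)) *ₗ α v)
      ≈⟨ interchange x _ _ _ ⟩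
    T v x +ᴹ (a *ₗ root r +ᴹ (a * (- p)) *ₗ α v)
      ≈⟨ +ᴹ-congˡ (+ᴹ-congˡ (*ₗ-assoc a (- p) (α v))) ⟩
    T v x +ᴹ (a *ₗ root r +ᴹ a *ₗ ((- p) *ₗ α v))
      ≈⟨ +ᴹ-congˡ (*ₗ-distribˡ a (root r) _) ⟨
    T v x +ᴹ a *ₗ (root r +ᴹ (- p) *ₗ α v)
      ≈⟨ +ᴹ-congˡ (*ₗ-congˡ (root-σ v r)) ⟨
    T v x +ᴹ a *ₗ root (σ v r) ∎
    where
    open SetoidReasoning ≈ᴹ-setoid
    open CommutativeSemigroupProperties
      (CommutativeMonoid.commutativeSemigroup +ᴹ-commutativeMonoid) using (interchange)
    l = level x (simple v)
    p = ⟨ root r , αᵛ v ⟩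
    scalars : - level (x +ᴹ a *ₗ root r) (simple v) ≈ - l + a * (- p)
    scalars = trans (-‿cong (level-+* x a (root r) (simple v)))
      (solve 3 (λ l a p → :- (l :+ a :* p) := :- l :+ a :* :- p) refl l a p)

  -- Words of reflections and the exchange argument

  Word : Set
  Word = List (Fin n)

  -- The last letter acts first.
  T* : Word → Carrierᴹ → Carrierᴹ
  T* w x = foldr T x w

  σ* : Word → Fin size → Fin size
  σ* w r = foldr σ r w

  T*-cong : ∀ w {x y} → x ≈ᴹ y → T* w x ≈ᴹ T* w y
  T*-cong []      x≈y = x≈y
  T*-cong (v ∷ w) x≈y = T-cong v (T*-cong w x≈y)

  T*-+root : ∀ w x a r → T* w (x +ᴹ a *ₗ root r) ≈ᴹ T* w x +ᴹ a *ₗ root (σ* w r)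
  T*-+root []      x a r = ≈ᴹ-refl
  T*-+root (v ∷ w) x a r = ≈ᴹ-trans (T-cong v (T*-+root w x a r)) (T-+root v (T* w x) a (σ* w r))

  level-T* : ∀ w x r → level (T* w x) (σ* w r) ≈ level x r
  level-T* []      x r = refl
  level-T* (v ∷ w) x r = begin
    level (T v (T* w x)) (σ v (σ* w r))  ≈⟨ level-T v (T* w x) _ ⟩
    level (T* w x) (σ v (σ v (σ* w r)))  ≡⟨ ≡.cong (level (T* w x)) (σ-involutive v (σ* w r)) ⟩
    level (T* w x) (σ* w r)              ≈⟨ level-T* w x r ⟩
    level x r                            ∎
    where open SetoidReasoning setoid

  -- The conjugate w T_k w⁻¹ translates along wα_k by minus the level at that root, so it is T_v
  -- once wα_k is α_v. Applying both sides after w keeps the inverse out of the statement.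
  T*-conjugation : ∀ {v k} w → σ* w (simple k) ≡ simple v →
                   ∀ x → T* w (T k x) ≈ᴹ T v (T* w x)
  T*-conjugation {v} {k} w wk≡v x = begin
    T* w (T k x)
      ≈⟨ T*-+root w x _ (simple k) ⟩
    T* w x +ᴹ (- level x (simple k)) *ₗ root (σ* w (simple k))
      ≈⟨ +ᴹ-congˡ (*ₗ-congʳ (-‿cong (level-T* w x (simple k)))) ⟨
    T* w x +ᴹ (- level (T* w x) (σ* w (simple k))) *ₗ root (σ* w (simple k))
      ≡⟨ ≡.cong (λ r → T* w x +ᴹ (- level (T* w x) r) *ₗ root r) wk≡v ⟩
    T v (T* w x) ∎
    where open SetoidReasoning ≈ᴹ-setoid

  -- The positive root α_k has become negative, so some letter v turns a positive image into a
  -- negative one. Since s_v does this only to α_v, the image before that letter is α_v. Conjugation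
  -- then moves T_k next to T_v as a second T_v, and the two cancel; both the letter v and the extra
  -- k are lost.
  exchange : ∀ k w → ¬ Positive (σ* w (simple k)) →
             ∃[ w′ ] (length w′ ℕ.< length w × ∀ x → T* w (T k x) ≈ᴹ T* w′ x)
  exchange k []      ¬pos = contradiction (simple-positive k) ¬pos
  exchange k (v ∷ w) ¬pos with positive? (σ* w (simple k))
  ... | no ¬pos′ =
    let w′ , w′<w , eq = exchange k w ¬pos′ in v ∷ w′ , ℕ.s≤s w′<w , T-cong v ∘ eq
  ... | yes pos with σ* w (simple k) Fin.≟ simple v
  ...   | no wk≢v  = contradiction (σ-positive pos wk≢v) ¬pos
  ...   | yes wk≡v = w , ℕ.≤-refl ,
    λ x → ≈ᴹ-trans (T-cong v (T*-conjugation w wk≡v x)) (T-involutive v (T* w x))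

  Dominant : Carrierᴹ → Set _
  Dominant x = ∀ v → 0# ≤ level x (simple v)

  -- The dominance order, with coefficients in the field rather than in ℕ because levels are field
  -- elements.
  Below : Carrierᴹ → Carrierᴹ → Set _
  Below y x = ∃[ k ] ((∀ j → 0# ≤ k j) × x ≈ᴹ y +ᴹ linComb k α)

  dominant-level-nonneg : ∀ {x} → Dominant x → ∀ {r} → Positive r → 0# ≤ level x r
  dominant-level-nonneg {x} dom pos = Λ-nonneg pos λ j → ≤-respʳ-≈ (level-simple x j) (dom j)

  -- Strip the letter k that acts first. If wα_k is positive, T_k subtracts, after applying w, the
  -- nonnegative level of x at α_k times a positive root, and induction bounds `T* w x`. If it is
  -- negative, `exchange` gives a shorter word for the same point. That word is not a subterm, hence
  -- the induction on a length bound.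
  dominant-maximal : ∀ {x} → Dominant x → ∀ w → Below (T* w x) x
  dominant-maximal {x} dom w = bounded (length w) w ℕ.≤-refl
    where
    open SetoidReasoning ≈ᴹ-setoid
    length-∷ʳ : ∀ (k : Fin n) w → length (w ∷ʳ k) ≡ suc (length w)
    length-∷ʳ k w = ≡.trans (length-++ w) (ℕ.+-comm (length w) 1)
    bounded : ∀ l w → length w ℕ.≤ l → Below (T* w x) x
    bounded l w w≤l with initLast w
    bounded l _ w≤l | [] =
      (λ _ → 0#) , (λ _ → inj₂ refl) ,
      ≈ᴹ-sym (≈ᴹ-trans (+ᴹ-congˡ (linComb-0 α)) (+ᴹ-identityʳ x))
    bounded zero _ w≤l | w ∷ʳ′ k = contradiction
      (≡.subst (ℕ._≤ 0) (length-∷ʳ k w) w≤l) λ ()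
    bounded (suc l) _ w≤l | w ∷ʳ′ k
      rewrite foldr-∷ʳ T x k w | length-∷ʳ k w with positive? (σ* w (simple k))
    ... | no ¬pos =
      let w′ , w′<w , eq = exchange k w ¬pos
          m , 0≤m , x≈ = bounded l w′ (ℕ.≤-trans (ℕ.<⇒≤ w′<w) (ℕ.s≤s⁻¹ w≤l))
      in m , 0≤m , ≈ᴹ-trans x≈ (+ᴹ-congʳ (≈ᴹ-sym (eq x)))
    ... | yes pos =
      let m , 0≤m , x≈ = bounded l w (ℕ.s≤s⁻¹ w≤l)
          β = σ* w (simple k)
          a = level x (simple k)
      in (λ j → a * rootCoefficient β j + m j) ,
         (λ j → +-nonneg (*-nonneg (dom k) (rootCoefficient-nonneg pos j)) (0≤m j)) ,
         (begin
           x
             ≈⟨ x≈ ⟩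
           T* w x +ᴹ linComb m α
             ≈⟨ +ᴹ-congʳ (+*ₗ-cancelʳ (T* w x) a (root β)) ⟨
           ((T* w x +ᴹ (- a) *ₗ root β) +ᴹ a *ₗ root β) +ᴹ linComb m α
             ≈⟨ +ᴹ-assoc _ _ _ ⟩
           (T* w x +ᴹ (- a) *ₗ root β) +ᴹ (a *ₗ root β +ᴹ linComb m α)
             ≈⟨ +ᴹ-cong (T*-+root w x (- a) (simple k))
                  (≈ᴹ-trans (linComb-+ (λ j → a * rootCoefficient β j) m α)
                    (+ᴹ-congʳ (≈ᴹ-trans (linComb-* a (rootCoefficient β) α)
                                        (*ₗ-congˡ (≈ᴹ-sym (root-expansion β)))))) ⟨
           T* w (T k x) +ᴹ linComb (λ j → a * rootCoefficient β j + m j) α ∎)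

  T*-inverse : ∀ w → ∃[ w′ ] (∀ x → T* w′ (T* w x) ≈ᴹ x)
  T*-inverse []      = [] , λ x → ≈ᴹ-refl
  T*-inverse (v ∷ w) =
    let w′ , inv = T*-inverse w in w′ ∷ʳ v , λ x → begin
      T* (w′ ∷ʳ v) (T v (T* w x))  ≡⟨ foldr-∷ʳ T _ v w′ ⟩
      T* w′ (T v (T v (T* w x)))   ≈⟨ T*-cong w′ (T-involutive v (T* w x)) ⟩
      T* w′ (T* w x)               ≈⟨ inv x ⟩
      x                            ∎
    where open SetoidReasoning ≈ᴹ-setoid

  -- `dominant-maximal` starts from the dominant point, so w is undone first: the word w′w⁻¹ leads
  -- from `T* w x` to `T* w′ x`.
  dominant-maximal-orbit : ∀ {x} w w′ → Dominant (T* w x) → Below (T* w′ x) (T* w x)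
  dominant-maximal-orbit {x} w w′ dom =
    let u , inv = T*-inverse w
        k , 0≤k , eq = dominant-maximal dom (w′ ++ u)
    in k , 0≤k , ≈ᴹ-trans eq (+ᴹ-congʳ (≈ᴹ-trans (≈ᴹ-reflexive (foldr-++ T (T* w x) w′ u))
                                                (T*-cong w′ (inv x))))

  -- Negative levels: their number and their total

  negative : Carrier → Bool
  negative a = does (a <? 0#)

  negative-cong : ∀ {a b} → a ≈ b → negative a ≡ negative b
  negative-cong a≈b = does-⇔ (mk⇔ (<-respˡ-≈ a≈b) (<-respˡ-≈ (sym a≈b))) (_ <? 0#) (_ <? 0#)

  negativeCount : Carrierᴹ → ℕ
  negativeCount x = sumOver ℕ.+-0-rawMonoid positive? λ r → if negative (level x r) then 1 else 0

  negativePart : Carrier → Carrier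
  negativePart a = if negative a then - a else 0#

  deficit : Carrierᴹ → Carrier
  deficit x = sumOver +-rawMonoid positive? λ r → negativePart (level x r)

  negativePart-cong : ∀ {a b} → a ≈ b → negativePart a ≈ negativePart b
  negativePart-cong {a} {b} a≈b = trans
    (reflexive (≡.cong (if_then - a else 0#) (negative-cong a≈b)))
    (step (negative b))
    where
    step : ∀ p → (if p then - a else 0#) ≈ (if p then - b else 0#)
    step true  = -‿cong a≈b
    step false = refl

  negativePart-< : ∀ {a} → a < 0# → negativePart a ≈ - a
  negativePart-< {a} a<0 with a <? 0#
  ... | yes _   = refl
  ... | no a≮0 = contradiction a<0 a≮0

  negativePart-≥ : ∀ {a} → 0# ≤ a → negativePart a ≈ 0#
  negativePart-≥ {a} 0≤a with a <? 0#
  ... | yes a<0 = contradiction a<0 (≤⇒≯ 0≤a)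
  ... | no _    = refl

  negativePart-neg : ∀ {a} → 0# ≤ a → negativePart (- a) ≈ a
  negativePart-neg {a} (inj₁ 0<a) = trans
    (negativePart-< (0<-⇒<0 (<-respʳ-≈ (sym (⁻¹-involutive a)) 0<a))) (⁻¹-involutive a)
    where open GroupProperties +-group using (⁻¹-involutive)
  negativePart-neg {a} (inj₂ 0≈a) = trans
    (negativePart-≥ (inj₂ (sym (trans (-‿cong (sym 0≈a)) ε⁻¹≈ε)))) 0≈a

  module _ {v x} (l<0 : level x (simple v) < 0#) where
    private
      0<l′ : 0# < level x (σ v (simple v))
      0<l′ = <-respʳ-≈ (sym (level-σ-simple x v)) (<0⇒0<- l<0)

    -- After reindexing by σ only α_v and -α_v matter: α_v was counted, while -α_v has positive
    -- level and adds nothing.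
    negativeCount-T : suc (negativeCount (T v x)) ≡ negativeCount x
    negativeCount-T = begin
      suc (negativeCount (T v x))
        ≡⟨ ℕ.+-comm 1 _ ⟩
      negativeCount (T v x) ℕ.+ 1
        ≡⟨ ≡.cong₂ ℕ._+_
             (SumOver.sumOver-cong ℕ.+-0-commutativeMonoid positive? λ r _ →
               ≡.cong (if_then 1 else 0) (negative-cong (level-T v x r)))
             (≡.cong (if_then 1 else 0) (≡.sym (dec-true (_ <? 0#) l<0))) ⟩
      sumOver ℕ.+-0-rawMonoid positive? (count ∘ σ v) ℕ.+ count (simple v)
        ≡⟨ positiveSum-σ ℕ.+-0-commutativeMonoid v count ⟩
      negativeCount x ℕ.+ count (σ v (simple v))
        ≡⟨ ≡.cong (λ b → negativeCount x ℕ.+ (if b then 1 else 0))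
                  (dec-false (_ <? 0#) (≤⇒≯ (<⇒≤ 0<l′))) ⟩
      negativeCount x ℕ.+ 0
        ≡⟨ ℕ.+-identityʳ _ ⟩
      negativeCount x ∎
      where
      open ≡-Reasoning
      count : Fin size → ℕ
      count r = if negative (level x r) then 1 else 0

    -- The same bookkeeping, weighted: the term of α_v that disappears is minus its level.
    deficit-T : deficit (T v x) + - level x (simple v) ≈ deficit x
    deficit-T = begin
      deficit (T v x) + - level x (simple v)
        ≈⟨ +-cong
             (SumOver.sumOver-cong +-commutativeMonoid positive? λ r _ →
               negativePart-cong (level-T v x r))
             (sym (negativePart-< l<0)) ⟩
      sumOver +-rawMonoid positive? (part ∘ σ v) + part (simple v)
        ≈⟨ positiveSum-σ +-commutativeMonoid v part ⟩
      deficit x + part (σ v (simple v))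
        ≈⟨ +-congˡ (negativePart-≥ (<⇒≤ 0<l′)) ⟩
      deficit x + 0#
        ≈⟨ +-identityʳ _ ⟩
      deficit x ∎
      where
      open SetoidReasoning setoid
      part : Fin size → Carrier
      part r = negativePart (level x r)

  deficit-cong : ∀ {x y} → x ≈ᴹ y → deficit x ≈ deficit y
  deficit-cong x≈y = SumOver.sumOver-cong +-commutativeMonoid positive? λ r _ →
    negativePart-cong (level-cong x≈y r)

  negativeCount-cong : ∀ {x y} → x ≈ᴹ y → negativeCount x ≡ negativeCount y
  negativeCount-cong x≈y = SumOver.sumOver-cong ℕ.+-0-commutativeMonoid positive? λ r _ →
    ≡.cong (if_then 1 else 0) (negative-cong (level-cong x≈y r))

  deficit-dominant : ∀ {x} → Dominant x → deficit x ≈ 0#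
  deficit-dominant dom = SumOver.sumOver-ε +-commutativeMonoid positive? λ r pos →
    negativePart-≥ (dominant-level-nonneg dom pos)

-- Configurations as points of the space

sum-[]≔ : ∀ {n} (c : Vec ℕ n) v k → sum (c [ v ]≔ k) ℕ.+ lookup c v ≡ sum c ℕ.+ k
sum-[]≔ (x ∷ c) zero    k = xy∙z≈zy∙x k (sum c) x
  where open CommutativeSemigroupProperties ℕ.+-commutativeSemigroup using (xy∙z≈zy∙x)
sum-[]≔ (x ∷ c) (suc v) k = ≡.trans (ℕ.+-assoc x _ _)
  (≡.trans (≡.cong (x ℕ.+_) (sum-[]≔ c v k)) (≡.sym (ℕ.+-assoc x _ _)))

sum-replicate-0 : ∀ n → sum (replicate n 0) ≡ 0
sum-replicate-0 zero    = ≡.refl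
sum-replicate-0 (suc n) = sum-replicate-0 n

module KostantGame {c ℓ₁ ℓ₂ m ℓm} {K : OrderedField c ℓ₁ ℓ₂} {E : EuclideanSpace K m ℓm}
                   {Φ : RootSystem E} {n} (Δ : Base Φ n) (I : Subset n) where
  open OrderedField K
  open EuclideanSpace E
  open RootSystem Φ
  open Base Δ
  open Coroots Δ
  open Game Δ I
  open OrderedFieldProperties K
  open EuclideanSpaceProperties E
  open SimpleReflections Δ
  open AffineReflections Δ (fromℤ ∘ ε)
  open SemiringSum semiring using (sum-cong-≋; ∑-distrib-+) renaming (sum to ∑)
  open GroupProperties +-group using (⁻¹-involutive; inverseˡ-unique)
  open Solver using (solve; _:=_; _:+_; _:*_; :-_; con)

  fromℤ-sumOver : ∀ {k p} {P : Pred (Fin k) p} (P? : Decidable P) x →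
    fromℤ (sumOver ℤ.+-0-rawMonoid P? x) ≈ ∑ λ i → if does (P? i) then fromℤ (x i) else 0#
  fromℤ-sumOver {zero}  P? x = refl
  fromℤ-sumOver {suc k} P? x = trans (fromℤ-+ (if does (P? zero) then x zero else ℤ.0ℤ) _)
    (+-cong (step (does (P? zero))) (fromℤ-sumOver (P? ∘ suc) (x ∘ suc)))
    where
    step : ∀ b → fromℤ (if b then x zero else ℤ.0ℤ) ≈ (if b then fromℤ (x zero) else 0#)
    step true  = refl
    step false = refl

  point : Config → Carrierᴹ
  point c = linComb (λ j → fromℕ (lookup c j)) α

  cartan : ∀ u v → ⟨ α u , αᵛ v ⟩ ≈ fromℤ (cartanInteger (simple u) (simple v))
  cartan u v = proj₂ (crystallographic (simple v) (simple u))

  cartan-diagonal : ∀ v → ⟨ α v , αᵛ v ⟩ ≈ fromℤ (+ 2)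
  cartan-diagonal v = trans (⟨α,αᵛ⟩≈2 (nonzero (simple v))) (+-congˡ (sym (+-identityʳ 1#)))

  cartan-zero-sym : ∀ {u v} → cartanInteger (simple v) (simple u) ≡ ℤ.0ℤ → ⟨ α u , αᵛ v ⟩ ≈ 0#
  cartan-zero-sym {u} {v} eq = trans (⟨⟩-*ʳ _ (α u) (α v)) (trans (*-congˡ orthogonal) (zeroʳ _))
    where
    open SetoidReasoning setoid
    t = corootScale (simple u)
    orthogonal : ⟨ α u , α v ⟩ ≈ 0#
    orthogonal = *-cancelʳ (<⇒≉ (corootScale-pos (simple u))) (begin
      ⟨ α u , α v ⟩ * t  ≈⟨ *-congʳ (⟨⟩-sym (α u) (α v)) ⟩
      ⟨ α v , α u ⟩ * t  ≈⟨ *-comm _ t ⟩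
      t * ⟨ α v , α u ⟩  ≈⟨ sym (⟨⟩-*ʳ t (α v) (α u)) ⟩
      ⟨ α v , αᵛ u ⟩     ≈⟨ cartan v u ⟩
      fromℤ (cartanInteger (simple v) (simple u))  ≡⟨ ≡.cong fromℤ eq ⟩
      0#                 ≈⟨ zeroˡ t ⟨
      0# * t             ∎)

  -- The diagram sees the product of two Cartan integers, the demand only one of them. If either
  -- vanishes, the simple roots are orthogonal, and that is symmetric.
  edges-zero : ∀ {u v} → edges v u ≡ ℤ.0ℤ → ⟨ α u , αᵛ v ⟩ ≈ 0#
  edges-zero {u} {v} eq with ℤ.i*j≡0⇒i≡0∨j≡0 (cartanInteger (simple v) (simple u)) eq
  ... | inj₁ vu≡0 = cartan-zero-sym vu≡0
  ... | inj₂ uv≡0 = trans (cartan u v) (reflexive (≡.cong fromℤ uv≡0))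

  -- This compares the full pairing with the sum over neighbours term by term: the diagonal leaves
  -- 2c_v, a neighbour cancels against its weight, and any other vertex is orthogonal.
  demand-split : ∀ c v u →
    fromℕ (lookup c u) * ⟨ α u , αᵛ v ⟩
      + (if does (neighbour? v u) then fromℤ (weight v u ℤ.* + lookup c u) else 0#)
    ≈ (if does (u Fin.≟ v) then fromℤ (+ 2) * fromℕ (lookup c u) else 0#)
  demand-split c v u with u Fin.≟ v
  ... | yes ≡.refl = trans (+-identityʳ _) (trans (*-congˡ (cartan-diagonal v)) (*-comm _ _))
  ... | no u≢v with edges v u ℤ.≟ ℤ.0ℤ
  ...   | yes e≡0 = trans (+-identityʳ _) (trans (*-congˡ (edges-zero e≡0)) (zeroʳ _))
  ...   | no _ = begin
    cᵤ * ⟨ α u , αᵛ v ⟩ + fromℤ (weight v u ℤ.* + lookup c u)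
      ≈⟨ +-cong (*-congˡ (cartan u v))
                (trans (fromℤ-* (weight v u) (+ lookup c u)) (*-congʳ (fromℤ-neg a))) ⟩
    cᵤ * fromℤ a + (- fromℤ a) * cᵤ
      ≈⟨ solve 2 (λ c a → c :* a :+ :- a :* c := con ℤ.0ℤ) refl cᵤ (fromℤ a) ⟩
    0# ∎
    where
    open SetoidReasoning setoid
    a = cartanInteger (simple u) (simple v)
    cᵤ = fromℕ (lookup c u)

  excess : Config → Fin n → ℤ
  excess c v = + 2 ℤ.* + lookup c v ℤ.- demand c v

  fromℤ-excess : ∀ c v →
    fromℤ (excess c v) ≈ fromℤ (+ 2) * fromℕ (lookup c v) + - fromℤ (demand c v)
  fromℤ-excess c v = trans (fromℤ-+ (+ 2 ℤ.* + lookup c v) (ℤ.- demand c v))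
    (+-cong (fromℤ-* (+ 2) (+ lookup c v)) (fromℤ-neg (demand c v)))

  level-point : ∀ c v → level (point c) (simple v) ≈ fromℤ (excess c v)
  level-point c v = begin
    level (point c) (simple v)
      ≈⟨ level-simple (point c) v ⟩
    ⟨ point c , αᵛ v ⟩ + - e
      ≈⟨ +-congʳ (⟨⟩-linCombˡ (λ j → fromℕ (lookup c j)) α (αᵛ v)) ⟩
    P + - e
      -- The neighbour sum S is added and subtracted: P + S collapses to 2c_v by `demand-split`, and
      -- S + e is the demand.
      ≈⟨ solve 3 (λ p s e → p :+ :- e := (p :+ s) :+ :- (s :+ e)) refl P S e ⟩
    (P + S) + - (S + e)
      ≈⟨ +-cong (trans (sym (∑-distrib-+ pairing supply))
                  (trans (sum-cong-≋ (demand-split c v)) (At.∑-at v double)))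
                (-‿cong (sym (trans (fromℤ-+ D (ε v))
                                    (+-congʳ (fromℤ-sumOver (neighbour? v) request))))) ⟩
    double v + - fromℤ (demand c v)
      ≈⟨ fromℤ-excess c v ⟨
    fromℤ (excess c v) ∎
    where
    open SetoidReasoning setoid
    module At = IndicatorSums +-commutativeMonoid
    request : Fin n → ℤ
    request u = weight v u ℤ.* + lookup c u
    D = sumOver ℤ.+-0-rawMonoid (neighbour? v) request
    pairing supply double : Fin n → Carrier
    pairing u = fromℕ (lookup c u) * ⟨ α u , αᵛ v ⟩
    supply u  = if does (neighbour? v u) then fromℤ (request u) else 0#
    double u  = fromℤ (+ 2) * fromℕ (lookup c u)
    P = ∑ pairing
    S = ∑ supply
    e = fromℤ (ε v)

  sad⇒level<0 : ∀ c {v} → Sad c v → level (point c) (simple v) < 0#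
  sad⇒level<0 c {v} sad = <-respˡ-≈ (sym (level-point c v)) (fromℤ-neg⁻
    (≡.subst (excess c v ℤ.<_) (ℤ.+-inverseʳ (demand c v))
      (ℤ.+-monoˡ-< (ℤ.- demand c v) sad)))

  final⇒dominant : ∀ c → Final c → Dominant (point c)
  final⇒dominant c fin v = ≤-respʳ-≈ (sym (level-point c v))
    (fromℤ-nonneg (ℤ.i≤j⇒0≤j-i (ℤ.≮⇒≥ (fin v))))

  module _ c {v k} (k≡ : + k ≡ demand c v ℤ.- + lookup c v) where
    private
      l = level (point c) (simple v)

    -- The value demand - c_v is c_v - (2c_v - demand), and the bracket is the level. Hence -l is
    -- both the translation of the point along α_v and the gain in chips.
    fired-chips : fromℕ k ≈ fromℕ (lookup c v) + - l
    fired-chips = begin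
      fromℕ k
        ≡⟨ ≡.cong fromℤ k≡ ⟩
      fromℤ (demand c v ℤ.- + lookup c v)
        ≈⟨ trans (fromℤ-+ (demand c v) _) (+-congˡ (fromℤ-neg (+ lookup c v))) ⟩
      fromℤ (demand c v) + - fromℕ (lookup c v)
        ≈⟨ solve 2 (λ d x → d :+ :- x := x :+ :- (con (+ 2) :* x :+ :- d)) refl
                   (fromℤ (demand c v)) (fromℕ (lookup c v)) ⟩
      fromℕ (lookup c v) + - (fromℤ (+ 2) * fromℕ (lookup c v) + - fromℤ (demand c v))
        ≈⟨ +-congˡ (-‿cong (trans (level-point c v) (fromℤ-excess c v))) ⟨
      fromℕ (lookup c v) + - l ∎
      where open SetoidReasoning setoid

    point-fire : point (c [ v ]≔ k) ≈ᴹ T v (point c)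
    point-fire = ≈ᴹ-trans (linComb-cong α entries)
      (linComb-+δ (λ j → fromℕ (lookup c j)) (- l) v α)
      where
      entries : ∀ j → fromℕ (lookup (c [ v ]≔ k) j) ≈ fromℕ (lookup c j) + (- l) * δ v j
      entries j with j Fin.≟ v
      ... | yes ≡.refl = trans (reflexive (≡.cong fromℕ (lookup∘update v c k)))
        (trans fired-chips (+-congˡ (sym (*-identityʳ _))))
      ... | no j≢v = trans (reflexive (≡.cong fromℕ (lookup∘update′ j≢v c k)))
        (sym (trans (+-congˡ (zeroʳ _)) (+-identityʳ _)))

    sum-fire : fromℕ (sum (c [ v ]≔ k)) ≈ fromℕ (sum c) + - l
    sum-fire = begin
      fromℕ (sum (c [ v ]≔ k))
        ≈⟨ solve 2 (λ s x → s := (s :+ x) :+ :- x) refl _ cᵥ ⟩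
      (fromℕ (sum (c [ v ]≔ k)) + cᵥ) + - cᵥ
        ≈⟨ +-congʳ (fromℕ-+ (sum (c [ v ]≔ k)) (lookup c v)) ⟨
      fromℕ (sum (c [ v ]≔ k) ℕ.+ lookup c v) + - cᵥ
        ≡⟨ ≡.cong (λ s → fromℕ s + - cᵥ) (sum-[]≔ c v k) ⟩
      fromℕ (sum c ℕ.+ k) + - cᵥ
        ≈⟨ +-congʳ (trans (fromℕ-+ (sum c) k) (+-congˡ fired-chips)) ⟩
      (fromℕ (sum c) + (cᵥ + - l)) + - cᵥ
        ≈⟨ solve 3 (λ s x l → (s :+ (x :+ :- l)) :+ :- x := s :+ :- l) refl
                   (fromℕ (sum c)) cᵥ l ⟩
      fromℕ (sum c) + - l ∎
      where
      open SetoidReasoning setoid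
      cᵥ = fromℕ (lookup c v)

  -- Termination

  measure : Config → ℕ
  measure c = negativeCount (point c)

  measure-⟶ : ∀ {c c′} → c ⟶ c′ → suc (measure c′) ≡ measure c
  measure-⟶ {c} (fire v sad k≡) =
    ≡.trans (≡.cong suc (negativeCount-cong (point-fire c k≡))) (negativeCount-T (sad⇒level<0 c sad))

  no-infinite-play : ∀ (s : ℕ → Config) → ¬ (∀ i → s i ⟶ s (suc i))
  no-infinite-play s step = descend (measure (s 0)) 0 ≡.refl
    where
    descend : ∀ k i → ¬ (measure (s i) ≡ k)
    descend zero    i eq = contradiction (≡.trans (measure-⟶ (step i)) eq) λ ()
    descend (suc k) i eq =
      descend k (suc i) (ℕ.suc-injective (≡.trans (measure-⟶ (step i)) eq))

  sad? : ∀ c v → Dec (Sad c v)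
  sad? c v = _ ℤ.<? _

  fireable : ∀ c {v} → Sad c v → ∃[ c′ ] c ⟶ c′
  -- The absolute value changes nothing, because a sad vertex has demand > 2c_v ≥ c_v.
  fireable c {v} sad = _ , fire v {ℤ.∣ demand c v ℤ.- + x ∣} sad
    (ℤ.0≤i⇒+∣i∣≡i (ℤ.i≤j⇒0≤j-i (ℤ.≤-trans x≤2x (ℤ.<⇒≤ sad))))
    where
    x = lookup c v
    x≤2x : + x ℤ.≤ + 2 ℤ.* + x
    x≤2x = ≡.subst (+ x ℤ.≤_) (ℤ.pos-* 2 x) (ℤ.+≤+ (ℕ.m≤m+n x _))

  play-to-end : ∀ c → ∃[ c′ ] (Star _⟶_ c c′ × Final c′)
  play-to-end c = go (measure c) c ≡.refl
    where
    go : ∀ k c → measure c ≡ k → ∃[ c′ ] (Star _⟶_ c c′ × Final c′)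
    go k c eq with Fin.any? (sad? c)
    ... | no ¬sad = c , Star.ε , λ v sad → ¬sad (v , sad)
    go zero c eq | yes (_ , sad) =
      contradiction (≡.trans (measure-⟶ (proj₂ (fireable c sad))) eq) λ ()
    go (suc k) c eq | yes (_ , sad) =
      let c₁ , move = fireable c sad
          c₂ , play , fin = go k c₁ (ℕ.suc-injective (≡.trans (measure-⟶ move) eq))
      in c₂ , move ◅ play , fin

  -- Uniqueness of the final configuration

  play⇒word : ∀ {c c′} → Star _⟶_ c c′ → ∃[ w ] point c′ ≈ᴹ T* w (point c)
  play⇒word Star.ε = [] , ≈ᴹ-refl
  play⇒word {c} (fire v sad k≡ ◅ play) =
    let w , eq = play⇒word play in
    w ∷ʳ v , ≈ᴹ-trans eq (≈ᴹ-trans (T*-cong w (point-fire c k≡))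
                                   (≈ᴹ-reflexive (≡.sym (foldr-∷ʳ T (point c) v w))))

  linComb-injective : ∀ k l → linComb k α ≈ᴹ linComb l α → ∀ j → k j ≈ l j
  linComb-injective k l eq j = begin
    k j             ≈⟨ inverseˡ-unique _ _ (independent (λ i → k i + - 1# * l i) zeroSum j) ⟩
    - (- 1# * l j)  ≈⟨ -‿cong (-1*x≈-x (l j)) ⟩
    - - l j         ≈⟨ ⁻¹-involutive (l j) ⟩
    l j             ∎
    where
    open SetoidReasoning setoid
    open RingProperties ring using (-1*x≈-x)
    zeroSum : linComb (λ i → k i + - 1# * l i) α ≈ᴹ 0ᴹ
    zeroSum = ≈ᴹ-trans (linComb-+ k _ α) (≈ᴹ-trans
      (+ᴹ-cong (≈ᴹ-trans eq (≈ᴹ-sym (*ₗ-identityˡ _))) (linComb-* (- 1#) l α))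
      (≈ᴹ-trans (≈ᴹ-sym (*ₗ-distribʳ _ 1# (- 1#))) (0*ₗ≈0 _ (-‿inverseʳ 1#))))

  below⇒≤ : ∀ c c′ → Below (point c) (point c′) →
            ∀ j → fromℕ (lookup c j) ≤ fromℕ (lookup c′ j)
  below⇒≤ c c′ (k , 0≤k , eq) j = ≤-respʳ-≈
    (sym (linComb-injective (λ i → fromℕ (lookup c′ i)) (λ i → fromℕ (lookup c i) + k i)
           (≈ᴹ-trans eq (≈ᴹ-sym (linComb-+ _ k α))) j))
    (≤-+-nonneg (0≤k j))

  -- Both points lie in the orbit of the starting point and the final one is dominant; independence
  -- of the simple roots turns `Below` into inequalities of entries. Here c′ may be any
  -- configuration reached, which makes the comparison usable in both directions.
  final-maximal : ∀ {c₀ c c′} → Star _⟶_ c₀ c → Final c → Star _⟶_ c₀ c′ →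
                  ∀ j → fromℕ (lookup c′ j) ≤ fromℕ (lookup c j)
  final-maximal {c₀} {c} {c′} play fin play′ =
    let w , eq = play⇒word play
        w′ , eq′ = play⇒word play′
        k , 0≤k , below = dominant-maximal-orbit w w′ λ v →
          ≤-respʳ-≈ (level-cong eq (simple v)) (final⇒dominant c fin v)
    in below⇒≤ c′ c (k , 0≤k , ≈ᴹ-trans eq (≈ᴹ-trans below (+ᴹ-congʳ (≈ᴹ-sym eq′))))

  final-unique : ∀ {c₀ c c′} → Star _⟶_ c₀ c → Final c → Star _⟶_ c₀ c′ → Final c′ → c ≡ c′
  final-unique {c₀} {c} {c′} play fin play′ fin′ = begin
    c                    ≡⟨ tabulate∘lookup c ⟨
    tabulate (lookup c)  ≡⟨ tabulate-cong entries ⟩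
    tabulate (lookup c′) ≡⟨ tabulate∘lookup c′ ⟩
    c′                   ∎
    where
    open ≡-Reasoning
    entries : ∀ j → lookup c j ≡ lookup c′ j
    -- `fromℕ k` is `fromℤ (+ k)` by definition, so injectivity on ℤ applies to chip numbers.
    entries j = ℤ.+-injective (fromℤ-injective
      (≤-antisym (final-maximal play′ fin′ play j) (final-maximal play fin play′ j)))

  -- The number of chips

  chips-deficit-⟶ : ∀ {c c′} → c ⟶ c′ →
    fromℕ (sum c′) + deficit (point c′) ≈ fromℕ (sum c) + deficit (point c)
  chips-deficit-⟶ {c} (fire v {k} sad k≡) = begin
    fromℕ (sum (c [ v ]≔ k)) + deficit (point (c [ v ]≔ k))
      ≈⟨ +-cong (sum-fire c k≡) (deficit-cong (point-fire c k≡)) ⟩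
    (fromℕ (sum c) + - l) + deficit (T v (point c))
      ≈⟨ solve 3 (λ s l d → (s :+ l) :+ d := s :+ (d :+ l)) refl (fromℕ (sum c)) (- l) _ ⟩
    fromℕ (sum c) + (deficit (T v (point c)) + - l)
      ≈⟨ +-congˡ (deficit-T (sad⇒level<0 c sad)) ⟩
    fromℕ (sum c) + deficit (point c) ∎
    where
    open SetoidReasoning setoid
    l = level (point c) (simple v)

  chips-deficit : ∀ {c c′} → Star _⟶_ c c′ →
    fromℕ (sum c′) + deficit (point c′) ≈ fromℕ (sum c) + deficit (point c)
  chips-deficit Star.ε        = refl
  chips-deficit (move ◅ play) = trans (chips-deficit play) (chips-deficit-⟶ move)

  point-start : point start ≈ᴹ 0ᴹ
  point-start = ≈ᴹ-trans
    (linComb-cong α λ j → reflexive (≡.cong fromℕ (lookup-replicate j 0))) (linComb-0 α)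

  Λ-height : ∀ r → Λ (fromℤ ∘ ε) r ≈ height I r
  Λ-height r = sum-cong-≋ λ j → step (does (j ∈? I)) (coefficient r j)
    where
    step : ∀ b x → x * fromℤ (if b then ℤ.1ℤ else ℤ.0ℤ) ≈ (if b then x else 0#)
    step true  x = trans (*-congˡ (+-identityʳ 1#)) (*-identityʳ x)
    step false x = zeroʳ x

  Λ-ε-nonneg : ∀ {r} → Positive r → 0# ≤ Λ (fromℤ ∘ ε) r
  Λ-ε-nonneg pos = Λ-nonneg pos λ j → step (does (j ∈? I))
    where
    step : ∀ b → 0# ≤ fromℤ (if b then ℤ.1ℤ else ℤ.0ℤ)
    step true  = fromℕ-nonneg 1
    step false = fromℕ-nonneg 0

  height-inSpan : ∀ {r} → InSpan (∁ I) r → height I r ≈ 0#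
  height-inSpan {r} (k , eq , vanish) = SumOver.sumOver-ε +-commutativeMonoid (_∈? I)
    λ j j∈I → trans (sym (coefficient-unique r k eq j)) (vanish j (x∈p⇒x∉∁p j∈I))

  deficit-0 : deficit 0ᴹ ≈ heightSum I
  deficit-0 = trans
    (SumOver.sumOver-cong +-commutativeMonoid positive? λ r pos →
      trans (negativePart-cong (level-0 r))
            (trans (negativePart-neg (Λ-ε-nonneg pos)) (Λ-height r)))
    (SumOver.sumOver-∖ +-commutativeMonoid positive? (inSpan? (∁ I)) λ r _ → height-inSpan)

  sum-final : ∀ {c} → Star _⟶_ start c → Final c → fromℕ (sum c) ≈ heightSum I
  sum-final {c} play fin = begin
    fromℕ (sum c)                              ≈⟨ +-identityʳ _ ⟨
    fromℕ (sum c) + 0#                         ≈⟨ +-congˡ (deficit-dominant (final⇒dominant c fin)) ⟨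
    fromℕ (sum c) + deficit (point c)          ≈⟨ chips-deficit play ⟩
    fromℕ (sum start) + deficit (point start)  ≈⟨ +-cong (reflexive (≡.cong fromℕ (sum-replicate-0 n)))
                                                         (deficit-cong point-start) ⟩
    0# + deficit 0ᴹ                            ≈⟨ +-identityˡ _ ⟩
    deficit 0ᴹ                                 ≈⟨ deficit-0 ⟩
    heightSum I                                ∎
    where open SetoidReasoning setoid hiding (start)

theorem3p10 : ∀ {c ℓ₁ ℓ₂ m ℓm} {K : OrderedField c ℓ₁ ℓ₂} {E : EuclideanSpace K m ℓm}
    (Φ : RootSystem E) {n : ℕ} (Δ : Base Φ n) (I : Subset n) →
    Σ[ final ∈ Game.Config Δ I ]
    (Game.TerminatesUniquelyAt Δ I final ×
    OrderedField._≈_ K (OrderedField.fromℕ K (sum final)) (Coroots.heightSum Δ I))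
theorem3p10 Φ Δ I =
  let final , play , isFinal = play-to-end (Game.start Δ I)
  in final ,
     record
       { no-infinite-play = λ (s , _ , step) → no-infinite-play s step
       ; reachable        = play
       ; isFinal          = isFinal
       ; unique           = λ c play′ fin′ → final-unique play′ fin′ play isFinal
       } ,
     sum-final play isFinal
  where open KostantGame Δ I
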